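{- Let $i,j,k$ be even positive integers. Then the eggbeater graph $E_{i,j,k}$ has exactly one edge-Kempe equivalence class of $3$-edge-colorings.
   Context: Graphs are finite, simple and undirected. A $3$-edge-coloring of a cubic (i.e. $3$-regular) graph is a partition of its edge set into $3$ (unlabeled) color classes such that no two adjacent edges are in the same class. Given a $3$-edge-coloring of a cubic graph, the union of any two of its color classes is a disjoint union of cycles of even length, whose edges alternate between the two colors; an edge-Kempe switch interchanges the two colors along one such cycle, yielding another $3$-edge-coloring. Two $3$-edge-colorings of the same graph are edge-Kempe equivalent if one can be obtained from the other by a (possibly empty) finite sequence of edge-Kempe switches; the equivalence classes of this relation are the edge-Kempe equivalence classes. For $n\ge 1$, the ladder graph $L_n$ is $P_2\times P_n$ (Cartesian product): it has vertices $x_1,\dots,x_n,y_1,\dots,y_n$, rungs $\{x_t,y_t\}$ for $1\le t\le n$, and edges $\{x_t,x_{t+1}\}$, $\{y_t,y_{t+1}\}$ for $1\le t\le n-1$. The ladder graph with pendants $LP_n$ is obtained from $L_n$ by adding four new vertices $v_a,v_b,v_c,v_d$ and the four pendant edges $e_a=\{v_a,x_1\}$, $e_b=\{v_b,y_1\}$, $e_c=\{v_c,x_n\}$, $e_d=\{v_d,y_n\}$. The eggbeater graph $E_{i,j,k}$ is obtained from disjoint copies of $LP_i$, $LP_j$ and $LP_k$ by merging the three copies of $v_a$ into one vertex, the three copies of $v_b$ into one vertex, the three copies of $v_c$ into one vertex, and the three copies of $v_d$ into one vertex. It is a cubic graph of order $2(i+j+k)+4$. -}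

module Defs where

open import Data.Fin.Base using (Fin; zero; suc; fromℕ; inject₁)
open import Data.Fin.Patterns using (0F; 1F; 2F; 3F)
open import Data.Fin.Permutation.Components using (transpose)
open import Data.Fin.Properties using (+↔⊎; inject₁-injective; suc-injective)
open import Data.Nat.Base using (ℕ; zero; suc; _+_; NonZero)
open import Data.Product.Base using (Σ; ∃; _×_; _,_)
open import Data.Sum.Base using (_⊎_; inj₁; inj₂)
open import Data.Sum.Function.Propositional using (_⊎-↔_)
open import Data.Vec.Functional using ([]; _∷_)
open import Function.Base using (_∘_)
open import Function.Bundles using (_↔_; _⇔_; mk↔ₛ′)
open import Function.Construct.Identity using (↔-id)
open import Function.Properties.Inverse using (↔-sym; ↔-trans)
open import Relation.Binary.Construct.Closure.ReflexiveTransitive using (Star)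
open import Relation.Binary.Construct.Union using (_∪_)
open import Relation.Binary.PropositionalEquality using (_≡_; _≢_; refl; cong)
open import Relation.Nullary using (¬_)

------------------------------------------------------------------------
-- Finite simple undirected graphs

-- The order of the two ends of an edge carries no meaning: `simple`
-- identifies edges whose ends agree up to exchanging them, and everything
-- below uses an edge only through `Incident`.
record Graph : Set₁ where
  field
    Vertex   : Set
    Edge     : Set
    src tgt  : Edge → Vertex
    loopless : ∀ e → src e ≢ tgt e
    simple   : ∀ e f → (src e ≡ src f × tgt e ≡ tgt f) ⊎
                       (src e ≡ tgt f × tgt e ≡ src f) → e ≡ f
    order    : ℕ
    vertices : Vertex ↔ Fin order
    size     : ℕ
    edges    : Edge ↔ Fin size

  Incident : Vertex → Edge → Set
  Incident v e = v ≡ src e ⊎ v ≡ tgt e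

  Adjacent : Edge → Edge → Set
  Adjacent e f = e ≢ f × ∃ λ v → Incident v e × Incident v f

------------------------------------------------------------------------
-- 3-edge-colorings and edge-Kempe equivalence

module _ (G : Graph) where
  open Graph G

  record Coloring : Set where
    field
      color  : Edge → Fin 3
      proper : ∀ {e f} → Adjacent e f → color e ≢ color f

  open Coloring

  -- A coloring is a partition into unlabeled classes, so two labeled
  -- colorings inducing the same partition count as the same coloring.
  SamePartition : Coloring → Coloring → Set
  SamePartition c d = ∀ e f → color c e ≡ color c f ⇔ color d e ≡ color d f

  Colored : Coloring → Fin 3 → Fin 3 → Edge → Set
  Colored c a b e = color c e ≡ a ⊎ color c e ≡ b

  -- For a cubic graph every vertex meets exactly one edge of each color, so
  -- the cycles of which the union of classes a and b is the disjoint union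
  -- are its connected components.  `SameCycle c a b e` is the component
  -- containing e, provided that e itself has color a or b.
  SameCycle : Coloring → Fin 3 → Fin 3 → Edge → Edge → Set
  SameCycle c a b =
    Star (λ e f → Adjacent e f × Colored c a b e × Colored c a b f)

  record Switch (c d : Coloring) : Set where
    field
      a b      : Fin 3
      distinct : a ≢ b
      base     : Edge
      colored  : Colored c a b base
      on       : ∀ e → SameCycle c a b base e →
                 color d e ≡ transpose a b (color c e)
      off      : ∀ e → ¬ SameCycle c a b base e → color d e ≡ color c e

  -- A finite sequence of switches between partitions; relabeling the
  -- colors is free.
  KempeEquivalent : Coloring → Coloring → Set
  KempeEquivalent = Star (SamePartition ∪ Switch)

  ExactlyOneKempeClass : Set
  ExactlyOneKempeClass = Coloring × (∀ c d → KempeEquivalent c d)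

------------------------------------------------------------------------
-- Ladders

data LadderVertex (n : ℕ) : Set where
  x[_] y[_] : Fin n → LadderVertex n

data LadderEdge : ℕ → Set where
  rung        : ∀ {n} → Fin n → LadderEdge n
  xrail yrail : ∀ {n} → Fin n → LadderEdge (suc n)

module _ where
  private
    source target : ∀ {n} → LadderEdge n → LadderVertex n
    source (rung t)  = x[ t ]
    source (xrail t) = x[ inject₁ t ]
    source (yrail t) = y[ inject₁ t ]
    target (rung t)  = y[ t ]
    target (xrail t) = x[ suc t ]
    target (yrail t) = y[ suc t ]

    x-injective : ∀ {n} {s t : Fin n} → x[ s ] ≡ x[ t ] → s ≡ t
    x-injective refl = refl

    y-injective : ∀ {n} {s t : Fin n} → y[ s ] ≡ y[ t ] → s ≡ t
    y-injective refl = refl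

    inject₁≢suc : ∀ {n} (t : Fin n) → inject₁ t ≢ suc t
    inject₁≢suc (suc t) p = inject₁≢suc t (suc-injective p)

    crossed : ∀ {n} (s t : Fin n) → inject₁ s ≡ suc t → ¬ suc s ≡ inject₁ t
    crossed (suc s) (suc t) p q =
      crossed s t (suc-injective p) (suc-injective q)

    no-loop : ∀ {n} (e : LadderEdge n) → source e ≢ target e
    no-loop (rung _)  ()
    no-loop (xrail t) p = inject₁≢suc t (x-injective p)
    no-loop (yrail t) p = inject₁≢suc t (y-injective p)

    no-parallel : ∀ {n} (e f : LadderEdge n) →
                  (source e ≡ source f × target e ≡ target f) ⊎
                  (source e ≡ target f × target e ≡ source f) → e ≡ f
    no-parallel (rung _)  (rung _)  (inj₁ (refl , _)) = refl
    no-parallel (rung _)  (rung _)  (inj₂ (() , _))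
    no-parallel (rung _)  (xrail _) (inj₁ (_ , ()))
    no-parallel (rung _)  (xrail _) (inj₂ (_ , ()))
    no-parallel (rung _)  (yrail _) (inj₁ (() , _))
    no-parallel (rung _)  (yrail _) (inj₂ (() , _))
    no-parallel (xrail _) (rung _)  (inj₁ (_ , ()))
    no-parallel (xrail _) (rung _)  (inj₂ (() , _))
    no-parallel (xrail _) (xrail _) (inj₁ (p , _)) =
      cong xrail (inject₁-injective (x-injective p))
    no-parallel (xrail s) (xrail t) (inj₂ (p , q))
      with () ← crossed s t (x-injective p) (x-injective q)
    no-parallel (xrail _) (yrail _) (inj₁ (() , _))
    no-parallel (xrail _) (yrail _) (inj₂ (() , _))
    no-parallel (yrail _) (rung _)  (inj₁ (() , _))
    no-parallel (yrail _) (rung _)  (inj₂ (_ , ()))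
    no-parallel (yrail _) (xrail _) (inj₁ (() , _))
    no-parallel (yrail _) (xrail _) (inj₂ (() , _))
    no-parallel (yrail _) (yrail _) (inj₁ (p , _)) =
      cong yrail (inject₁-injective (y-injective p))
    no-parallel (yrail s) (yrail t) (inj₂ (p , q))
      with () ← crossed s t (y-injective p) (y-injective q)

    vertex↔ : ∀ n → LadderVertex n ↔ Fin (n + n)
    vertex↔ n = ↔-trans sum (↔-sym +↔⊎)
      where
      sum : LadderVertex n ↔ (Fin n ⊎ Fin n)
      sum = mk↔ₛ′ (λ { x[ t ] → inj₁ t ; y[ t ] → inj₂ t })
                  (λ { (inj₁ t) → x[ t ] ; (inj₂ t) → y[ t ] })
                  (λ { (inj₁ _) → refl ; (inj₂ _) → refl })
                  (λ { x[ _ ] → refl ; y[ _ ] → refl })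

    edgeCount : ℕ → ℕ
    edgeCount zero    = 0
    edgeCount (suc n) = suc n + (n + n)

    edge↔ : ∀ n → LadderEdge n ↔ Fin (edgeCount n)
    edge↔ zero    = mk↔ₛ′ (λ { (rung ()) }) (λ ()) (λ ()) (λ { (rung ()) })
    edge↔ (suc n) =
      ↔-trans sum (↔-trans (↔-id _ ⊎-↔ ↔-sym +↔⊎) (↔-sym +↔⊎))
      where
      sum : LadderEdge (suc n) ↔ (Fin (suc n) ⊎ (Fin n ⊎ Fin n))
      sum = mk↔ₛ′
        (λ { (rung t) → inj₁ t ; (xrail t) → inj₂ (inj₁ t)
           ; (yrail t) → inj₂ (inj₂ t) })
        (λ { (inj₁ t) → rung t ; (inj₂ (inj₁ t)) → xrail t
           ; (inj₂ (inj₂ t)) → yrail t })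
        (λ { (inj₁ _) → refl ; (inj₂ (inj₁ _)) → refl
           ; (inj₂ (inj₂ _)) → refl })
        (λ { (rung _) → refl ; (xrail _) → refl ; (yrail _) → refl })

  Ladder : ℕ → Graph
  Ladder n = record
    { Vertex   = LadderVertex n
    ; Edge     = LadderEdge n
    ; src      = source
    ; tgt      = target
    ; loopless = no-loop
    ; simple   = no-parallel
    ; vertices = vertex↔ n
    ; edges    = edge↔ n
    }

------------------------------------------------------------------------
-- Ladders with pendants

data Pendant : Set where
  va vb vc vd : Pendant

Pendant↔Fin4 : Pendant ↔ Fin 4
Pendant↔Fin4 = mk↔ₛ′
  (λ { va → 0F ; vb → 1F ; vc → 2F ; vd → 3F })
  (λ { 0F → va ; 1F → vb ; 2F → vc ; 3F → vd })
  (λ { 0F → refl ; 1F → refl ; 2F → refl ; 3F → refl })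
  (λ { va → refl ; vb → refl ; vc → refl ; vd → refl })

attach : ∀ {n} .{{_ : NonZero n}} → Pendant → LadderVertex n
attach {suc n} va = x[ zero ]
attach {suc n} vb = y[ zero ]
attach {suc n} vc = x[ fromℕ n ]
attach {suc n} vd = y[ fromℕ n ]

-- `inj₁ p` is the pendant vertex p, respectively the pendant edge ending
-- in p; `inj₂` embeds the ladder.
module _ (n : ℕ) .{{_ : NonZero n}} where
  private
    module L = Graph (Ladder n)

    LPVertex LPEdge : Set
    LPVertex = Pendant ⊎ L.Vertex
    LPEdge   = Pendant ⊎ L.Edge

    source target : LPEdge → LPVertex
    source (inj₁ p) = inj₂ (attach p)
    source (inj₂ e) = inj₂ (L.src e)
    target (inj₁ p) = inj₁ p
    target (inj₂ e) = inj₂ (L.tgt e)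

    inj₂-injective : ∀ {u v : L.Vertex} →
                     _≡_ {A = LPVertex} (inj₂ u) (inj₂ v) → u ≡ v
    inj₂-injective refl = refl

    no-loop : ∀ e → source e ≢ target e
    no-loop (inj₁ _) ()
    no-loop (inj₂ e) p = L.loopless e (inj₂-injective p)

    no-parallel : ∀ e f →
                  (source e ≡ source f × target e ≡ target f) ⊎
                  (source e ≡ target f × target e ≡ source f) → e ≡ f
    no-parallel (inj₁ _) (inj₁ _) (inj₁ (_ , refl)) = refl
    no-parallel (inj₁ _) (inj₁ _) (inj₂ (() , _))
    no-parallel (inj₁ _) (inj₂ _) (inj₁ (_ , ()))
    no-parallel (inj₁ _) (inj₂ _) (inj₂ (_ , ()))
    no-parallel (inj₂ _) (inj₁ _) (inj₁ (_ , ()))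
    no-parallel (inj₂ _) (inj₁ _) (inj₂ (() , _))
    no-parallel (inj₂ e) (inj₂ f) (inj₁ (p , q)) =
      cong inj₂ (L.simple e f (inj₁ (inj₂-injective p , inj₂-injective q)))
    no-parallel (inj₂ e) (inj₂ f) (inj₂ (p , q)) =
      cong inj₂ (L.simple e f (inj₂ (inj₂-injective p , inj₂-injective q)))

  LadderWithPendants : Graph
  LadderWithPendants = record
    { Vertex   = LPVertex
    ; Edge     = LPEdge
    ; src      = source
    ; tgt      = target
    ; loopless = no-loop
    ; simple   = no-parallel
    ; vertices = ↔-trans (Pendant↔Fin4 ⊎-↔ L.vertices) (↔-sym +↔⊎)
    ; edges    = ↔-trans (Pendant↔Fin4 ⊎-↔ L.edges) (↔-sym +↔⊎)
    }

------------------------------------------------------------------------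
-- Eggbeater graphs

Σ-Fin3↔ : (P : Fin 3 → Set) (n : Fin 3 → ℕ) → (∀ c → P c ↔ Fin (n c)) →
          Σ (Fin 3) P ↔ Fin (n 0F + (n 1F + n 2F))
Σ-Fin3↔ P n finite =
  ↔-trans sum
    (↔-trans (finite 0F ⊎-↔ ↔-trans (finite 1F ⊎-↔ finite 2F) (↔-sym +↔⊎))
             (↔-sym +↔⊎))
  where
  sum : Σ (Fin 3) P ↔ (P 0F ⊎ (P 1F ⊎ P 2F))
  sum = mk↔ₛ′
    (λ { (0F , p) → inj₁ p ; (1F , p) → inj₂ (inj₁ p)
       ; (2F , p) → inj₂ (inj₂ p) })
    (λ { (inj₁ p) → 0F , p ; (inj₂ (inj₁ p)) → 1F , p
       ; (inj₂ (inj₂ p)) → 2F , p })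
    (λ { (inj₁ _) → refl ; (inj₂ (inj₁ _)) → refl ; (inj₂ (inj₂ _)) → refl })
    (λ { (0F , _) → refl ; (1F , _) → refl ; (2F , _) → refl })

-- The copies of LP_(n c), for c : Fin 3, with equally named pendant
-- vertices merged: `merge c` is the quotient map restricted to copy c.  The
-- edge set is the disjoint union of those of the three copies.
module _ (n : Fin 3 → ℕ) .(nonZero : ∀ c → NonZero (n c)) where
  private
    module LP (c : Fin 3) = Graph (LadderWithPendants (n c) {{nonZero c}})

    MergedVertex MergedEdge : Set
    MergedVertex = Pendant ⊎ Σ (Fin 3) (LadderVertex ∘ n)
    MergedEdge   = Σ (Fin 3) LP.Edge

    merge : ∀ c → LP.Vertex c → MergedVertex
    merge c (inj₁ p) = inj₁ p
    merge c (inj₂ v) = inj₂ (c , v)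

    source target : MergedEdge → MergedVertex
    source (c , e) = merge c (LP.src c e)
    target (c , e) = merge c (LP.tgt c e)

    merge-injective : ∀ c u v → merge c u ≡ merge c v → u ≡ v
    merge-injective c (inj₁ _) (inj₁ _) refl = refl
    merge-injective c (inj₂ _) (inj₂ _) refl = refl

    no-loop : ∀ e → source e ≢ target e
    no-loop (c , e) p = LP.loopless c e (merge-injective c _ _ p)

    same-copy : ∀ c d u v → merge c (inj₂ u) ≡ merge d v → c ≡ d
    same-copy c d u (inj₂ v) refl = refl

    source-copy : ∀ c d e v → merge c (LP.src c e) ≡ merge d v → c ≡ d
    source-copy c d (inj₁ _) v = same-copy c d _ v
    source-copy c d (inj₂ _) v = same-copy c d _ v

    no-parallel : ∀ e f →
                  (source e ≡ source f × target e ≡ target f) ⊎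
                  (source e ≡ target f × target e ≡ source f) → e ≡ f
    no-parallel (c , e) (d , f) (inj₁ (p , q))
      with refl ← source-copy c d e _ p =
      cong (c ,_) (LP.simple c e f
        (inj₁ (merge-injective c _ _ p , merge-injective c _ _ q)))
    no-parallel (c , e) (d , f) (inj₂ (p , q))
      with refl ← source-copy c d e _ p =
      cong (c ,_) (LP.simple c e f
        (inj₂ (merge-injective c _ _ p , merge-injective c _ _ q)))

  MergedLadders : Graph
  MergedLadders = record
    { Vertex   = MergedVertex
    ; Edge     = MergedEdge
    ; src      = source
    ; tgt      = target
    ; loopless = no-loop
    ; simple   = no-parallel
    ; vertices = ↔-trans
        (Pendant↔Fin4 ⊎-↔ Σ-Fin3↔ _ _ (λ c → Graph.vertices (Ladder (n c))))
        (↔-sym +↔⊎)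
    ; edges    = Σ-Fin3↔ _ _ LP.edges
    }

Eggbeater : (i j k : ℕ) →
            .{{_ : NonZero i}} .{{_ : NonZero j}} .{{_ : NonZero k}} → Graph
Eggbeater i j k {{i≢0}} {{j≢0}} {{k≢0}} =
  MergedLadders (i ∷ j ∷ k ∷ [])
    (λ { 0F → i≢0 ; 1F → j≢0 ; 2F → k≢0 })

{-# OPTIONS --safe #-}
module Submission where

-- Two colorings that have a color class in common are Kempe equivalent: they
-- differ on whole cycles of the other two classes.  So it suffices to connect
-- any two colorings by a chain in which neighbors share a class, and cycles
-- never have to be traced.
--
-- At the left end of a ladder with pendants the two pendant edges have equal
-- or different colors.  If different, the coloring is forced: both sides
-- alternate between the two colors, and since the length is even the same two
-- colors appear at the right end.  If equal, both sides carry the same walk in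
-- ℤ/3, and any walk is possible.  Chains of colorings as above remove the copies
-- whose pendant colors differ.
--
-- Let δ be half the number of up-steps minus down-steps of a walk.  Adjacent
-- steps can be exchanged (a switch of a 4-cycle), so only δ matters, and
-- walks starting at p and q = p + 1 can exchange their starts until both reach
-- the third color r.  With suitable prefixes this changes (δ , δ′) to
-- (δ + 1 , δ′ - 1) or to (δ - 2 , δ′ - 1).  As the three walks end in different
-- colors, some such changes always lower the sum of the |δ|, until all δ are 0.
-- The remaining colorings differ by a permutation of the colors, that is, by
-- transpositions, each of which fixes a class.

open import Defs
open import Data.Empty using (⊥-elim)
open import Data.Fin.Base using (Fin; fromℕ; inject₁; suc; zero)
open import Data.Fin.Patterns using (0F; 1F; 2F)
open import Data.Fin.Permutation.Components using (transpose)
open import Data.Fin.Properties as Fin using (_≟_; all?; inj⇒≟)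
open import Data.Fin.Relation.Unary.Top
  using (view; view-fromℕ; view-inject₁; ‵fromℕ; ‵inject₁)
open import Data.Integer.Base using (+0; +[1+_]; +_; -[1+_]; -_; ℤ; ∣_∣)
open import Data.Integer.Properties using (neg-involutive; ∣-i∣≡∣i∣)
open import Data.List.Base using (List; []; _∷_; allFin; map)
open import Data.List.Membership.Propositional using (_∈_)
open import Data.List.Membership.Propositional.Properties using (∈-allFin; ∈-map⁺)
open import Data.List.Relation.Unary.Any using (here; there)
open import Data.Nat.Base
  using (NonZero; _*_; _+_; _<_; _≤_; compare; equal; greater; less; suc; s≤s; zero; ℕ)
open import Data.Nat.Divisibility using (_∣_; divides)
open import Data.Nat.Properties
  using (*-comm; +-assoc; +-cancelˡ-≡; +-comm; +-identityʳ; +-monoʳ-≤; +-monoˡ-≤; +-suc;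
         n≤1+n; suc-injective; ≤-refl; ≤-reflexive; ≤-trans)
open import Data.Product.Base using (_,_; _×_; proj₁; proj₂; ∃; ∃₂)
open import Data.Sum.Base using (_⊎_; inj₁; inj₂)
open import Data.Sum.Properties using (inj₁-injective; inj₂-injective)
open import Data.Vec.Base using (Vec; []; _∷_)
open import Function.Base using (_∘_)
open import Function.Bundles using (Inverse; mk⇔)
open import Function.Properties.Inverse using (↔⇒↣)
open import Relation.Binary.Construct.Closure.ReflexiveTransitive
  using (Star; _◅_; _◅◅_; gmap; return; reverse; ε)
open import Relation.Binary.Definitions using (DecidableEquality; Symmetric)
open import Relation.Binary.PropositionalEquality
  using (_≡_; _≢_; cong; cong₂; refl; subst; subst₂; sym; trans; ≢-sym)
open import Relation.Nullary using (Dec; no; yes; ¬?; ¬_)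
open import Relation.Nullary.Decidable
  using (True; _×-dec_; _→-dec_; _⊎-dec_; decidable-stable; from-yes; map′; toWitness)

-- Three colors, and decidable reachability in a finite set.

Distinct : {A : Set} → A → A → A → Set
Distinct p q r = p ≢ q × q ≢ r × p ≢ r

abstract
  one-of-three : {p q r : Fin 3} → Distinct p q r → ∀ x → x ≡ p ⊎ x ≡ q ⊎ x ≡ r
  one-of-three {p} {q} {r} d x = from-yes
    (all? λ (p : Fin 3) → all? λ (q : Fin 3) → all? λ (r : Fin 3) → all? λ (x : Fin 3) →
      (¬? (p ≟ q) ×-dec ¬? (q ≟ r) ×-dec ¬? (p ≟ r)) →-dec
      (x ≟ p ⊎-dec x ≟ q ⊎-dec x ≟ r))
    p q r x d

  transpose-left : (a b : Fin 3) → transpose a b a ≡ b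
  transpose-left = from-yes (all? λ (a : Fin 3) → all? λ (b : Fin 3) → transpose a b a ≟ b)

  transpose-right : (a b : Fin 3) → transpose a b b ≡ a
  transpose-right = from-yes (all? λ (a : Fin 3) → all? λ (b : Fin 3) → transpose a b b ≟ a)

-- Equivalent to `x ≡ r ⇔ y ≡ r`: required at every edge, it says that two colorings have the same
-- class `r`.
Agree : Fin 3 → Fin 3 → Fin 3 → Set
Agree r x y = x ≡ y ⊎ (x ≢ r × y ≢ r)

Agree-sym : ∀ {r x y} → Agree r x y → Agree r y x
Agree-sym (inj₁ p)       = inj₁ (sym p)
Agree-sym (inj₂ (p , q)) = inj₂ (q , p)

-- Warshall's algorithm: in Via zs, all intermediate points lie in zs.
module Reachability {A : Set} (R : A → A → Set) (_≟ᴬ_ : DecidableEquality A)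
                    (R? : ∀ x y → Dec (R x y)) where

  Via : List A → A → A → Set
  Via []       x y = x ≡ y ⊎ R x y
  Via (z ∷ zs) x y = Via zs x y ⊎ (Via zs x z × Via zs z y)

  via? : ∀ zs x y → Dec (Via zs x y)
  via? []       x y = x ≟ᴬ y ⊎-dec R? x y
  via? (z ∷ zs) x y = via? zs x y ⊎-dec (via? zs x z ×-dec via? zs z y)

  via-sound : ∀ zs {x y} → Via zs x y → Star R x y
  via-sound []       (inj₁ refl)    = ε
  via-sound []       (inj₂ r)       = return r
  via-sound (z ∷ zs) (inj₁ p)       = via-sound zs p
  via-sound (z ∷ zs) (inj₂ (p , q)) = via-sound zs p ◅◅ via-sound zs q

  via-direct : ∀ zs {x y} → x ≡ y ⊎ R x y → Via zs x y
  via-direct []       p = p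
  via-direct (z ∷ zs) p = inj₁ (via-direct zs p)

  via-join : ∀ {zs x y z} → z ∈ zs → Via zs x z → Via zs z y → Via zs x y
  via-join (here refl) p q = inj₂ (to-head p , from-head q)
    where
    to-head : ∀ {z zs x} → Via (z ∷ zs) x z → Via zs x z
    to-head (inj₁ p)       = p
    to-head (inj₂ (p , _)) = p
    from-head : ∀ {z zs y} → Via (z ∷ zs) z y → Via zs z y
    from-head (inj₁ q)       = q
    from-head (inj₂ (_ , q)) = q
  via-join (there m) (inj₁ p)         (inj₁ q)         = inj₁ (via-join m p q)
  via-join (there m) (inj₁ p)         (inj₂ (q , q′))  = inj₂ (via-join m p q , q′)
  via-join (there m) (inj₂ (p , p′))  (inj₁ q)         = inj₂ (p , via-join m p′ q)
  -- Both paths visit the head of the list, so the part between the two visits, and with it `z`, is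
  -- cut out.
  via-join (there m) (inj₂ (p , _))   (inj₂ (_ , q))   = inj₂ (p , q)

  via-complete : ∀ {zs} → (∀ z → z ∈ zs) → ∀ {x y} → Star R x y → Via zs x y
  via-complete {zs} all ε       = via-direct zs (inj₁ refl)
  via-complete {zs} all (r ◅ p) =
    via-join (all _) (via-direct zs (inj₂ r)) (via-complete all p)

  reachable? : ∀ {zs} → (∀ z → z ∈ zs) → ∀ x y → Dec (Star R x y)
  reachable? {zs} all x y = map′ (via-sound zs) (via-complete all) (via? zs x y)

-- Colorings with a common class are Kempe equivalent.

module SharedClass (G : Graph) where
  open Graph G
  open Coloring

  Share : Coloring G → Coloring G → Set
  Share c d = ∃ λ r → ∀ e → Agree r (color c e) (color d e)

  Share-sym : Symmetric Share
  Share-sym (r , s) = r , Agree-sym ∘ s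

  _≟ᵉ_ : DecidableEquality Edge
  _≟ᵉ_ = inj⇒≟ (↔⇒↣ edges)

  _≟ᵛ_ : DecidableEquality Vertex
  _≟ᵛ_ = inj⇒≟ (↔⇒↣ vertices)

  every-edge : List Edge
  every-edge = map (Inverse.from edges) (allFin size)

  ∈-every-edge : ∀ e → e ∈ every-edge
  ∈-every-edge e = subst (_∈ every-edge) (Inverse.strictlyInverseʳ edges e)
    (∈-map⁺ (Inverse.from edges) (∈-allFin (Inverse.to edges e)))

  incident? : ∀ v e → Dec (Incident v e)
  incident? v e = v ≟ᵛ src e ⊎-dec v ≟ᵛ tgt e

  adjacent? : ∀ e f → Dec (Adjacent e f)
  adjacent? e f = ¬? (e ≟ᵉ f) ×-dec
    map′ (λ { (inj₁ p) → src e , inj₁ refl , p ; (inj₂ p) → tgt e , inj₂ refl , p })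
         (λ { (v , inj₁ refl , p) → inj₁ p ; (v , inj₂ refl , p) → inj₂ p })
         (incident? (src e) f ⊎-dec incident? (tgt e) f)

  Adjacent-sym : ∀ {e f} → Adjacent e f → Adjacent f e
  Adjacent-sym (e≢f , v , p , q) = e≢f ∘ sym , v , q , p

  module _ (c : Coloring G) (a b : Fin 3) where

    Colored? : ∀ e → Dec (Colored G c a b e)
    Colored? e = color c e ≟ a ⊎-dec color c e ≟ b

    abstract
      -- A recoloring along one cycle is defined by cases on membership, which therefore has to be
      -- decidable. Opaque, so that the search is never unfolded.
      same-cycle? : ∀ e f → Dec (SameCycle G c a b e f)
      same-cycle? = Reachability.reachable? _ _≟ᵉ_
        (λ e f → adjacent? e f ×-dec Colored? e ×-dec Colored? f) ∈-every-edge

    cycle-colored : ∀ {e f} → SameCycle G c a b e f →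
                    Colored G c a b e → Colored G c a b f
    cycle-colored ε                 q = q
    cycle-colored ((_ , _ , q) ◅ p) _ = cycle-colored p q

  -- Two colorings with a common class r differ on whole cycles of the other
  -- two classes: if they differ at e, and f is next to e on such a cycle,
  -- then both exchange the colors of e and f.
  module _ (r : Fin 3) (c d : Coloring G)
           (agree : ∀ e → Agree r (color c e) (color d e))
           (base : Edge) (differ : color c base ≢ color d base) where

    private
      a b : Fin 3
      a = color c base
      b = color d base

      abr : Distinct a b r
      abr with agree base
      ... | inj₁ p       = ⊥-elim (differ p)
      ... | inj₂ (p , q) = differ , q , p

      ab-of : ∀ x → x ≢ r → x ≡ a ⊎ x ≡ b
      ab-of x x≢r with one-of-three abr x
      ... | inj₁ p        = inj₁ p
      ... | inj₂ (inj₁ p) = inj₂ p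
      ... | inj₂ (inj₂ p) = ⊥-elim (x≢r p)

      ab-≢r : ∀ {x} → x ≡ a ⊎ x ≡ b → x ≢ r
      ab-≢r (inj₁ refl) = proj₂ (proj₂ abr)
      ab-≢r (inj₂ refl) = proj₁ (proj₂ abr)

      Swapped : Edge → Set
      Swapped e = (color c e ≡ a × color d e ≡ b) ⊎ (color c e ≡ b × color d e ≡ a)

      swapped : ∀ e → Colored G c a b e → color c e ≢ color d e → Swapped e
      swapped e q p with agree e
      ... | inj₁ p′ = ⊥-elim (p p′)
      ... | inj₂ (_ , d≢r) with q | ab-of _ d≢r
      ... | inj₁ ca | inj₁ da = ⊥-elim (p (trans ca (sym da)))
      ... | inj₁ ca | inj₂ db = inj₁ (ca , db)
      ... | inj₂ cb | inj₁ da = inj₂ (cb , da)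
      ... | inj₂ cb | inj₂ db = ⊥-elim (p (trans cb (sym db)))

      step : ∀ {e f} → Adjacent e f → Colored G c a b f → Swapped e → Swapped f
      step {e} {f} adj q (inj₁ (ca , db)) = swapped f q λ cf≡df → proper d adj
        (trans db (trans (sym (other q)) cf≡df))
        where
        other : Colored G c a b f → color c f ≡ b
        other (inj₁ p) = ⊥-elim (proper c adj (trans ca (sym p)))
        other (inj₂ p) = p
      step {e} {f} adj q (inj₂ (cb , da)) = swapped f q λ cf≡df → proper d adj
        (trans da (trans (sym (other q)) cf≡df))
        where
        other : Colored G c a b f → color c f ≡ a
        other (inj₁ p) = p
        other (inj₂ p) = ⊥-elim (proper c adj (trans cb (sym p)))

      cycle-swapped : ∀ {e f} → SameCycle G c a b e f → Swapped e → Swapped f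
      cycle-swapped ε                   s = s
      cycle-swapped ((adj , _ , q) ◅ p) s = cycle-swapped p (step adj q s)

      on-cycle : ∀ e → Dec (SameCycle G c a b base e)
      on-cycle = same-cycle? c a b base

      swapped-on : ∀ {e} → SameCycle G c a b base e → Swapped e
      swapped-on p = cycle-swapped p (inj₁ (refl , refl))

      new : ∀ e → Dec (SameCycle G c a b base e) → Fin 3
      new e (yes _) = color d e
      new e (no  _) = color c e

      extend : ∀ {e f} → SameCycle G c a b base e → Adjacent e f →
               Colored G c a b f → SameCycle G c a b base f
      extend p adj q =
        p ◅◅ return (adj , cycle-colored c a b p (inj₁ refl) , q)

      -- If `color c f` were `a` or `b`, the cycle would extend from `e` to `f`; but `color d e` is
      -- one of these two.
      off-cycle : ∀ {e f} → SameCycle G c a b base e → Adjacent e f →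
                  ¬ SameCycle G c a b base f → color d e ≢ color c f
      off-cycle {e} {f} p adj ¬q eq with swapped-on p
      ... | inj₁ (_ , db) = ¬q (extend p adj (inj₂ (trans (sym eq) db)))
      ... | inj₂ (_ , da) = ¬q (extend p adj (inj₁ (trans (sym eq) da)))

      new-proper : ∀ {e f} p q → Adjacent e f → new e p ≢ new f q
      new-proper (yes _) (yes _) adj = proper d adj
      new-proper (yes p) (no ¬q) adj = off-cycle p adj ¬q
      new-proper (no ¬p) (yes q) adj = off-cycle q (Adjacent-sym adj) ¬p ∘ sym
      new-proper (no _)  (no _)  adj = proper c adj

    -- Follows `d` on the cycle through `base` and `c` elsewhere. On that cycle `d` is `c` with `a`
    -- and `b` exchanged, so this is one switch away from `c`.
    switched : Coloring G
    switched = record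
      { color  = λ e → new e (on-cycle e)
      ; proper = λ {e} {f} → new-proper (on-cycle e) (on-cycle f)
      }

    switched-choice : ∀ e → color switched e ≡ color d e ⊎ color switched e ≡ color c e
    switched-choice e with on-cycle e
    ... | yes _ = inj₁ refl
    ... | no  _ = inj₂ refl

    switched-base : color switched base ≡ color d base
    switched-base with on-cycle base
    ... | yes _ = refl
    ... | no ¬p = ⊥-elim (¬p ε)

    switch : Switch G c switched
    switch = record
      { a        = a
      ; b        = b
      ; distinct = differ
      ; base     = base
      ; colored  = inj₁ refl
      ; on       = λ e → on e (on-cycle e)
      ; off      = λ e → off e (on-cycle e)
      }
      where
      on : ∀ e dec → SameCycle G c a b base e → new e dec ≡ transpose a b (color c e)
      on e (no ¬p) p = ⊥-elim (¬p p)
      on e (yes _) p with swapped-on p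
      ... | inj₁ (ca , db) = trans db (sym (trans (cong (transpose a b) ca) (transpose-left a b)))
      ... | inj₂ (cb , da) = trans da (sym (trans (cong (transpose a b) cb) (transpose-right a b)))
      off : ∀ e dec → ¬ SameCycle G c a b base e → new e dec ≡ color c e
      off e (yes p) ¬p = ⊥-elim (¬p p)
      off e (no _)  _  = refl

  -- Induction on a list `es` that contains every edge where `c` and `d` differ. A switch at the
  -- head settles it and creates no new difference, since each edge keeps its color in `c` or takes
  -- the one in `d`; class `r` stays common for the same reason.
  kempe-on : ∀ es (c d : Coloring G) r → (∀ e → Agree r (color c e) (color d e)) →
             (∀ e → color c e ≢ color d e → e ∈ es) → KempeEquivalent G c d
  -- The colorings agree edge by edge but need not be equal as records, so a `SamePartition` step
  -- connects them.
  kempe-on [] c d r agree within = return (inj₁ λ e f →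
    mk⇔ (λ p → trans (sym (same-color e)) (trans p (same-color f)))
        (λ p → trans (same-color e) (trans p (sym (same-color f)))))
    where
    same-color : ∀ e → color c e ≡ color d e
    same-color e = decidable-stable (color c e ≟ color d e) λ p → nowhere (within e p)
      where
      nowhere : ¬ (e ∈ [])
      nowhere ()
  kempe-on (x ∷ es) c d r agree within with color c x ≟ color d x
  ... | yes p = kempe-on es c d r agree λ e q → later e q (within e q)
    where
    later : ∀ e → color c e ≢ color d e → e ∈ (x ∷ es) → e ∈ es
    later e q (here refl) = ⊥-elim (q p)
    later e q (there m)   = m
  ... | no p = inj₂ (switch r c d agree x p) ◅ kempe-on es c′ d r agree′ within′
    where
    c′ = switched r c d agree x p
    choice = switched-choice r c d agree x p
    agree′ : ∀ e → Agree r (color c′ e) (color d e)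
    agree′ e with choice e
    ... | inj₁ q = inj₁ q
    ... | inj₂ q = subst (λ k → Agree r k (color d e)) (sym q) (agree e)
    within′ : ∀ e → color c′ e ≢ color d e → e ∈ es
    within′ e q with choice e
    ... | inj₁ q′ = ⊥-elim (q q′)
    ... | inj₂ q′ with within e (q ∘ trans q′)
    ... | here refl = ⊥-elim (q (switched-base r c d agree x p))
    ... | there m   = m

  share⇒kempe : ∀ c d → Share c d → KempeEquivalent G c d
  share⇒kempe c d (r , agree) = kempe-on every-edge c d r agree λ e _ → ∈-every-edge e

  infix 4 _≃_
  _≃_ : Coloring G → Coloring G → Set
  _≃_ = Star Share

  ≃-sym : Symmetric _≃_
  ≃-sym = reverse λ {c} {d} → Share-sym {c} {d}

  ≃⇒kempe : ∀ {c d} → c ≃ d → KempeEquivalent G c d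
  ≃⇒kempe ε       = ε
  ≃⇒kempe {c} (_◅_ {j = d} s p) = share⇒kempe c d s ◅◅ ≃⇒kempe p

-- Colorings of a single ladder with pendants.

data Side : Set where
  top bottom : Side

node : ∀ {n} → Side → Fin n → LadderVertex n
node top    t = x[ t ]
node bottom t = y[ t ]

rail : ∀ {n} → Side → Fin n → LadderEdge (suc n)
rail top    = xrail
rail bottom = yrail

first last : Side → Pendant
first top    = va
first bottom = vb
last  top    = vc
last  bottom = vd

LPEdge : ℕ → Set
LPEdge n = Pendant ⊎ LadderEdge n

-- The n + 1 edges at the vertices of one side, pendants included, are
-- numbered from 0 to n: the left one at vertex t is number t, the right one
-- number t + 1.
left right : ∀ {m} → Side → Fin (suc m) → LPEdge (suc m)
left s zero    = inj₁ (first s)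
left s (suc t) = inj₂ (rail s t)
right s t with view t
... | ‵fromℕ     = inj₁ (last s)
... | ‵inject₁ t = inj₂ (rail s t)

right-fromℕ : ∀ s m → right s (fromℕ m) ≡ inj₁ (last s)
right-fromℕ s m rewrite view-fromℕ m = refl

right-inject₁ : ∀ {m} s (t : Fin m) → right s (inject₁ t) ≡ inj₂ (rail s t)
right-inject₁ s t rewrite view-inject₁ t = refl

star : ∀ {n} → Side → Fin n → Fin 3 → LPEdge n
star {suc m} s t 0F = left s t
star {suc m} s t 1F = right s t
star {suc m} s t 2F = inj₂ (rung t)

-- A coloring listed along the two sides; `inject₁ t` and `suc t` number the edges left and right of
-- vertex `t`. Length 0 serves as the base of recursions.
record Lad (n : ℕ) : Set where
  field
    rails  : Side → Fin (suc n) → Fin 3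
    rungs  : Fin n → Fin 3
    proper : ∀ s t → Distinct (rails s (inject₁ t)) (rails s (suc t)) (rungs t)

open Lad

lad-color : ∀ {n} → Lad n → LPEdge n → Fin 3
lad-color     L (inj₁ va)        = rails L top zero
lad-color     L (inj₁ vb)        = rails L bottom zero
lad-color {n} L (inj₁ vc)        = rails L top (fromℕ n)
lad-color {n} L (inj₁ vd)        = rails L bottom (fromℕ n)
lad-color     L (inj₂ (rung t))  = rungs L t
-- Rail `t` is the right edge at vertex `inject₁ t` and so has number `suc (inject₁ t)`.
lad-color     L (inj₂ (xrail t)) = rails L top (suc (inject₁ t))
lad-color     L (inj₂ (yrail t)) = rails L bottom (suc (inject₁ t))

lad-color-first : ∀ {n} (L : Lad n) s → lad-color L (inj₁ (first s)) ≡ rails L s zero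
lad-color-first L top    = refl
lad-color-first L bottom = refl

lad-color-last : ∀ {n} (L : Lad n) s → lad-color L (inj₁ (last s)) ≡ rails L s (fromℕ n)
lad-color-last L top    = refl
lad-color-last L bottom = refl

lad-color-rail : ∀ {n} (L : Lad (suc n)) s t →
                 lad-color L (inj₂ (rail s t)) ≡ rails L s (suc (inject₁ t))
lad-color-rail L top    t = refl
lad-color-rail L bottom t = refl

lad-color-left : ∀ {m} (L : Lad (suc m)) s t → lad-color L (left s t) ≡ rails L s (inject₁ t)
lad-color-left L s zero    = lad-color-first L s
lad-color-left L s (suc t) = lad-color-rail L s t

lad-color-right : ∀ {m} (L : Lad (suc m)) s t → lad-color L (right s t) ≡ rails L s (suc t)
lad-color-right L s t with view t
... | ‵fromℕ     = lad-color-last L s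
... | ‵inject₁ t = lad-color-rail L s t

star-colors : ∀ {n} (L : Lad n) s t k l → k ≢ l →
              lad-color L (star s t k) ≢ lad-color L (star s t l)
star-colors {suc m} L s t k l k≢l q =
  separate k l k≢l (trans (colors k) (trans q (sym (colors l))))
  where
  color : Fin 3 → Fin 3
  color 0F = rails L s (inject₁ t)
  color 1F = rails L s (suc t)
  color 2F = rungs L t
  colors : ∀ k → color k ≡ lad-color L (star s t k)
  colors 0F = sym (lad-color-left L s t)
  colors 1F = sym (lad-color-right L s t)
  colors 2F = refl
  separate : ∀ k l → k ≢ l → color k ≢ color l
  separate 0F 0F q = ⊥-elim (q refl)
  separate 0F 1F q = proj₁ (proper L s t)
  separate 0F 2F q = proj₂ (proj₂ (proper L s t))
  separate 1F 0F q = proj₁ (proper L s t) ∘ sym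
  separate 1F 1F q = ⊥-elim (q refl)
  separate 1F 2F q = proj₁ (proj₂ (proper L s t))
  separate 2F 0F q = proj₂ (proj₂ (proper L s t)) ∘ sym
  separate 2F 1F q = proj₁ (proj₂ (proper L s t)) ∘ sym
  separate 2F 2F q = ⊥-elim (q refl)

inject₁≢suc : ∀ {m} (t : Fin m) → inject₁ t ≢ suc t
inject₁≢suc (suc t) q = inject₁≢suc t (Fin.suc-injective q)

rail-injective : ∀ {m} s {t u : Fin m} → inj₂ (rail s t) ≡ inj₂ {A = Pendant} (rail s u) → t ≡ u
rail-injective top    refl = refl
rail-injective bottom refl = refl

rail≢rung : ∀ {m} s {t : Fin m} {u} → rail s t ≢ rung u
rail≢rung top    ()
rail≢rung bottom ()

first≢last : ∀ s → first s ≢ last s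
first≢last top    ()
first≢last bottom ()

left≢rung : ∀ {m} s (t : Fin (suc m)) {u} → left s t ≢ inj₂ (rung u)
left≢rung s (suc t) q = rail≢rung s (inj₂-injective q)

right≢rung : ∀ {m} s (t : Fin (suc m)) {u} → right s t ≢ inj₂ (rung u)
right≢rung s t q with view t
... | ‵inject₁ t = rail≢rung s (inj₂-injective q)

left≢last : ∀ {m} s (t : Fin (suc m)) → left s t ≢ inj₁ (last s)
left≢last s zero q = first≢last s (inj₁-injective q)

left≢rail : ∀ {m} s (t : Fin (suc m)) {u} → t ≡ inject₁ u → left s t ≢ inj₂ (rail s u)
left≢rail s (suc t) p q with refl ← rail-injective s q = inject₁≢suc t (sym p)

left≢right : ∀ {m} s (t : Fin (suc m)) → left s t ≢ right s t
left≢right s t with view t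
... | ‵fromℕ     = left≢last s _
... | ‵inject₁ u = left≢rail s _ refl

covers : ∀ {n} .{{_ : NonZero n}} s (t : Fin n) e →
         Graph.Incident (LadderWithPendants n) (inj₂ (node s t)) e → ∃ λ k → e ≡ star s t k
covers {suc m} top    t (inj₁ va)        (inj₁ refl) = 0F , refl
covers {suc m} top    t (inj₁ vc)        (inj₁ refl) = 1F , sym (right-fromℕ top m)
covers {suc m} bottom t (inj₁ vb)        (inj₁ refl) = 0F , refl
covers {suc m} bottom t (inj₁ vd)        (inj₁ refl) = 1F , sym (right-fromℕ bottom m)
covers {suc m} top    t (inj₂ (rung t))  (inj₁ refl) = 2F , refl
covers {suc m} bottom t (inj₂ (rung t))  (inj₂ refl) = 2F , refl
covers {suc m} top    t (inj₂ (xrail u)) (inj₁ refl) = 1F , sym (right-inject₁ top u)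
covers {suc m} top    t (inj₂ (xrail u)) (inj₂ refl) = 0F , refl
covers {suc m} bottom t (inj₂ (yrail u)) (inj₁ refl) = 1F , sym (right-inject₁ bottom u)
covers {suc m} bottom t (inj₂ (yrail u)) (inj₂ refl) = 0F , refl

covered : ∀ {n} .{{_ : NonZero n}} s (t : Fin n) k →
          Graph.Incident (LadderWithPendants n) (inj₂ (node s t)) (star s t k)
covered {suc m} top    zero    0F = inj₁ refl
covered {suc m} bottom zero    0F = inj₁ refl
covered {suc m} top    (suc t) 0F = inj₂ refl
covered {suc m} bottom (suc t) 0F = inj₂ refl
covered {suc m} top    t       1F with view t
... | ‵fromℕ     = inj₁ refl
... | ‵inject₁ t = inj₁ refl
covered {suc m} bottom t       1F with view t
... | ‵fromℕ     = inj₁ refl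
... | ‵inject₁ t = inj₁ refl
covered {suc m} top    t       2F = inj₁ refl
covered {suc m} bottom t       2F = inj₂ refl

star-injective : ∀ {n} s (t : Fin n) k l → k ≢ l → star s t k ≢ star s t l
star-injective {suc m} s t = separate
  where
  separate : ∀ k l → k ≢ l → star s t k ≢ star s t l
  separate 0F 0F q = ⊥-elim (q refl)
  separate 0F 1F q = left≢right s t
  separate 0F 2F q = left≢rung s t
  separate 1F 0F q = left≢right s t ∘ sym
  separate 1F 1F q = ⊥-elim (q refl)
  separate 1F 2F q = right≢rung s t
  separate 2F 0F q = left≢rung s t ∘ sym
  separate 2F 1F q = right≢rung s t ∘ sym
  separate 2F 2F q = ⊥-elim (q refl)

module Read {m : ℕ} (c : LPEdge (suc m) → Fin 3)
            (separate : ∀ s t i j → i ≢ j → c (star s t i) ≢ c (star s t j)) where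

  read-rails : Side → Fin (suc (suc m)) → Fin 3
  read-rails s zero    = c (inj₁ (first s))
  read-rails s (suc t) = c (right s t)

  read-left : ∀ s t → read-rails s (inject₁ t) ≡ c (left s t)
  read-left s zero    = refl
  read-left s (suc t) = cong c (right-inject₁ s t)

  read-proper : ∀ s t → Distinct (read-rails s (inject₁ t)) (c (right s t)) (c (inj₂ (rung t)))
  read-proper s t rewrite read-left s t =
    separate s t 0F 1F (λ ()) , separate s t 1F 2F (λ ()) , separate s t 0F 2F (λ ())

  lad : Lad (suc m)
  lad = record
    { rails  = read-rails
    ; rungs  = λ t → c (inj₂ (rung t))
    ; proper = read-proper
    }

  lad-color-read : ∀ e → lad-color lad e ≡ c e
  lad-color-read (inj₁ va)        = refl
  lad-color-read (inj₁ vb)        = refl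
  lad-color-read (inj₁ vc)        = cong c (right-fromℕ top m)
  lad-color-read (inj₁ vd)        = cong c (right-fromℕ bottom m)
  lad-color-read (inj₂ (rung t))  = refl
  lad-color-read (inj₂ (xrail t)) = cong c (right-inject₁ top t)
  lad-color-read (inj₂ (yrail t)) = cong c (right-inject₁ bottom t)

read : ∀ {n} .{{_ : NonZero n}} (c : LPEdge n → Fin 3) →
       (∀ s t i j → i ≢ j → c (star s t i) ≢ c (star s t j)) →
       ∃ λ (L : Lad n) → ∀ e → lad-color L e ≡ c e
read {suc m} c separate = Read.lad c separate , Read.lad-color-read c separate

-- Gluing the colorings of three copies.

Injective₃ : (Fin 3 → Fin 3) → Set
Injective₃ f = ∀ {k l} → k ≢ l → f k ≢ f l

module Merged (n : Fin 3 → ℕ) .(nonZero : ∀ c → NonZero (n c)) where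

  G : Graph
  G = MergedLadders n nonZero

  open Graph G
  open SharedClass G public
  open Coloring

  module LP (c : Fin 3) = Graph (LadderWithPendants (n c) {{nonZero c}})

  incident-up : ∀ l {w} e → LP.Incident l (inj₂ w) e → Incident (inj₂ (l , w)) (l , e)
  incident-up l (inj₁ p) (inj₁ refl) = inj₁ refl
  incident-up l (inj₂ e) (inj₁ refl) = inj₁ refl
  incident-up l (inj₂ e) (inj₂ refl) = inj₂ refl

  incident-down : ∀ {l l′ w} e → Incident (inj₂ (l , w)) (l′ , e) →
                  ∃ λ w′ → (l , w) ≡ (l′ , w′) × LP.Incident l′ (inj₂ w′) e
  incident-down (inj₁ p) (inj₁ refl) = _ , refl , inj₁ refl
  incident-down (inj₁ p) (inj₂ ())
  incident-down (inj₂ e) (inj₁ refl) = _ , refl , inj₁ refl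
  incident-down (inj₂ e) (inj₂ refl) = _ , refl , inj₂ refl

  pendant-edge : ∀ {p} l e → Incident (inj₁ p) (l , e) → e ≡ inj₁ p
  pendant-edge l (inj₁ p) (inj₂ refl) = refl
  pendant-edge l (inj₁ p) (inj₁ ())
  pendant-edge l (inj₂ e) (inj₁ ())
  pendant-edge l (inj₂ e) (inj₂ ())

  Lads : Set
  Lads = ∀ l → Lad (n l)

  -- Properness inside a copy is part of `Lad`; only the four merged vertices, each meeting one
  -- pendant edge of every copy, impose a condition across copies.
  paint : (L : Lads) → (∀ p → Injective₃ λ l → lad-color (L l) (inj₁ p)) → Coloring G
  paint L boundary = record { color = color′ ; proper = proper′ _ _ }
    where
    color′ : Edge → Fin 3
    color′ (l , e) = lad-color (L l) e
    at-pendant : ∀ p l m e f → (l , e) ≢ (m , f) → e ≡ inj₁ p → f ≡ inj₁ p →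
                 color′ (l , e) ≢ color′ (m , f)
    at-pendant p l m _ _ q refl refl = boundary p λ { refl → q refl }
    at-star : ∀ l s t e f → (l , e) ≢ (l , f) →
              (∃ λ i → e ≡ star s t i) → (∃ λ j → f ≡ star s t j) →
              color′ (l , e) ≢ color′ (l , f)
    at-star l s t _ _ q (i , refl) (j , refl) = star-colors (L l) s t i j λ { refl → q refl }
    at-node : ∀ l s t e f → (l , e) ≢ (l , f) → LP.Incident l (inj₂ (node s t)) e →
              LP.Incident l (inj₂ (node s t)) f → color′ (l , e) ≢ color′ (l , f)
    at-node l s t e f q p p′ = at-star l s t e f q
      (covers {{nonZero l}} s t e p) (covers {{nonZero l}} s t f p′)
    proper′ : ∀ e f → Adjacent e f → color′ e ≢ color′ f
    proper′ (l , e) (m , f) (q , inj₁ p , i , j) =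
      at-pendant p l m e f q (pendant-edge l e i) (pendant-edge m f j)
    proper′ (l , e) (m , f) (q , inj₂ (k , w) , i , j)
      with incident-down {w = w} e i | incident-down {w = w} f j
    ... | x[ t ] , refl , i′ | _ , refl , j′ = at-node l top t e f q i′ j′
    ... | y[ t ] , refl , i′ | _ , refl , j′ = at-node l bottom t e f q i′ j′

  star-distinct : ∀ (c : Coloring G) l s t i j → i ≢ j →
                  color c (l , star s t i) ≢ color c (l , star s t j)
  star-distinct c l s t i j i≢j = proper c
    ( (λ { q → star-injective s t i j i≢j (same-copy q) })
    , inj₂ (l , node s t)
    , incident-up l _ (covered {{nonZero l}} s t i)
    , incident-up l _ (covered {{nonZero l}} s t j) )
    where
    same-copy : ∀ {e f} → (l , e) ≡ (l , f) → e ≡ f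
    same-copy refl = refl

  pendants-distinct : ∀ (c : Coloring G) p → Injective₃ λ l → color c (l , inj₁ p)
  pendants-distinct c p {k} {l} k≢l = proper c
    ((λ q → k≢l (cong proj₁ q)) , inj₁ p , inj₂ refl , inj₂ refl)

  lads-of : (c : Coloring G) → ∃ λ (L : Lads) → ∀ l e → lad-color (L l) e ≡ color c (l , e)
  lads-of c = proj₁ ∘ each , proj₂ ∘ each
    where
    each : ∀ l → ∃ λ (L : Lad (n l)) → ∀ e → lad-color L e ≡ color c (l , e)
    each l = read {{nonZero l}} (λ e → color c (l , e)) (star-distinct c l)

-- Walks in ℤ/3, straight and crossed colorings.

Distinct-rotate : {A : Set} {p q r : A} → Distinct p q r → Distinct q r p
Distinct-rotate (p≢q , q≢r , p≢r) = q≢r , ≢-sym p≢r , ≢-sym p≢q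

Distinct-swap : {A : Set} {p q r : A} → Distinct p q r → Distinct q p r
Distinct-swap (p≢q , q≢r , p≢r) = ≢-sym p≢q , p≢r , q≢r

third-of-three : {p q r : Fin 3} → Distinct p q r → ∀ {x} → x ≢ p → x ≢ q → x ≡ r
third-of-three D {x} x≢p x≢q with one-of-three D x
... | inj₁ q        = ⊥-elim (x≢p q)
... | inj₂ (inj₁ q) = ⊥-elim (x≢q q)
... | inj₂ (inj₂ q) = q

data Step : Set where
  ⊕ ⊖ : Step

opposite : Step → Step
opposite ⊕ = ⊖
opposite ⊖ = ⊕

opposite-involutive : ∀ x → opposite (opposite x) ≡ x
opposite-involutive ⊕ = refl
opposite-involutive ⊖ = refl

move : Step → Fin 3 → Fin 3
move ⊕ 0F = 1F
move ⊕ 1F = 2F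
move ⊕ 2F = 0F
move ⊖ 0F = 2F
move ⊖ 1F = 0F
move ⊖ 2F = 1F

up dn : Fin 3 → Fin 3
up = move ⊕
dn = move ⊖

step-distinct : ∀ x p → Distinct p (move x p) (move (opposite x) p)
step-distinct ⊕ 0F = (λ ()) , (λ ()) , (λ ())
step-distinct ⊕ 1F = (λ ()) , (λ ()) , (λ ())
step-distinct ⊕ 2F = (λ ()) , (λ ()) , (λ ())
step-distinct ⊖ 0F = (λ ()) , (λ ()) , (λ ())
step-distinct ⊖ 1F = (λ ()) , (λ ()) , (λ ())
step-distinct ⊖ 2F = (λ ()) , (λ ()) , (λ ())

step-towards : ∀ p q → p ≢ q → ∃ λ x → q ≡ move x p
step-towards 0F 0F p≢q = ⊥-elim (p≢q refl)
step-towards 0F 1F _   = ⊕ , refl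
step-towards 0F 2F _   = ⊖ , refl
step-towards 1F 0F _   = ⊖ , refl
step-towards 1F 1F p≢q = ⊥-elim (p≢q refl)
step-towards 1F 2F _   = ⊕ , refl
step-towards 2F 0F _   = ⊕ , refl
step-towards 2F 1F _   = ⊖ , refl
step-towards 2F 2F p≢q = ⊥-elim (p≢q refl)

move-back : ∀ x p → move (opposite x) (move x p) ≡ p
move-back ⊕ 0F = refl
move-back ⊕ 1F = refl
move-back ⊕ 2F = refl
move-back ⊖ 0F = refl
move-back ⊖ 1F = refl
move-back ⊖ 2F = refl

-- Since 2 = -1 in ℤ/3.
move-twice : ∀ x p → move x (move x p) ≡ move (opposite x) p
move-twice ⊕ 0F = refl
move-twice ⊕ 1F = refl
move-twice ⊕ 2F = refl
move-twice ⊖ 0F = refl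
move-twice ⊖ 1F = refl
move-twice ⊖ 2F = refl

private variable
  n : ℕ

-- A lad both of whose sides carry the same colors is given by its first
-- color p and a word u: the colors of a side form a walk in ℤ/3 with steps u.
walk : Fin 3 → Vec Step n → Fin (suc n) → Fin 3
walk p u       zero    = p
walk p (x ∷ u) (suc t) = walk (move x p) u t

end : Fin 3 → Vec Step n → Fin 3
end p []      = p
end p (x ∷ u) = end (move x p) u

walk-end : ∀ p (u : Vec Step n) → walk p u (fromℕ n) ≡ end p u
walk-end p []      = refl
walk-end p (x ∷ u) = walk-end (move x p) u

walk-rungs : Fin 3 → Vec Step n → Fin n → Fin 3
walk-rungs p (x ∷ u) zero    = move (opposite x) p
walk-rungs p (x ∷ u) (suc t) = walk-rungs (move x p) u t

straight : Fin 3 → Vec Step n → Lad n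
straight p u = record
  { rails  = λ _ → walk p u
  ; rungs  = walk-rungs p u
  ; proper = λ _ → walk-proper p u
  }
  where
  walk-proper : ∀ {n} p (u : Vec Step n) t →
                Distinct (walk p u (inject₁ t)) (walk p u (suc t)) (walk-rungs p u t)
  walk-proper p (x ∷ u) zero    = step-distinct x p
  walk-proper p (x ∷ u) (suc t) = walk-proper (move x p) u t

alternation : Fin 3 → Fin 3 → Fin (suc n) → Fin 3
alternation         p q zero    = p
alternation {suc n} p q (suc t) = alternation q p t

alternation-end : ∀ {n} h → n ≡ h * 2 → ∀ p q → alternation {n} p q (fromℕ n) ≡ p
alternation-end zero    refl p q = refl
alternation-end (suc h) refl p q = alternation-end h refl p q

alternation-≢ : ∀ {p q r} → p ≢ r → q ≢ r → ∀ (t : Fin (suc n)) → alternation p q t ≢ r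
alternation-≢         p≢r q≢r zero    = p≢r
alternation-≢ {suc n} p≢r q≢r (suc t) = alternation-≢ q≢r p≢r t

crossed : ∀ {p q r} → Distinct p q r → Lad n
crossed {p = p} {q} {r} D = record
  { rails  = λ { top → alternation p q ; bottom → alternation q p }
  ; rungs  = λ _ → r
  ; proper = λ { top → crossed-proper D ; bottom → crossed-proper (Distinct-swap D) }
  }
  where
  crossed-proper : ∀ {n p q r} → Distinct p q r → (t : Fin n) →
                   Distinct (alternation p q (inject₁ t)) (alternation p q (suc t)) r
  crossed-proper D zero    = D
  crossed-proper D (suc t) = crossed-proper (Distinct-swap D) t

-- Every coloring of a ladder is straight or crossed.

infix 4 _≈[_]_ _≗_
record _≈[_]_ (L : Lad n) (r : Fin 3) (M : Lad n) : Set where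
  constructor _,_
  field
    rails-agree : ∀ s t → Agree r (rails L s t) (rails M s t)
    rungs-agree : ∀ t → Agree r (rungs L t) (rungs M t)

open _≈[_]_

record _≗_ (L M : Lad n) : Set where
  constructor _,_
  field
    rails-equal : ∀ s t → rails L s t ≡ rails M s t
    rungs-equal : ∀ t → rungs L t ≡ rungs M t

open _≗_

≈-refl : ∀ {r} {L : Lad n} → L ≈[ r ] L
≈-refl = (λ _ _ → inj₁ refl) , (λ _ → inj₁ refl)

≗-≈ : ∀ {r} {L M N : Lad n} → L ≗ M → M ≈[ r ] N → L ≈[ r ] N
≗-≈ {r = r} {N = N} (e , e′) (a , a′) =
  (λ s t → subst (λ x → Agree r x (rails N s t)) (sym (e s t)) (a s t)) ,
  (λ t → subst (λ x → Agree r x (rungs N t)) (sym (e′ t)) (a′ t))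

≡-≈ : ∀ {r} {L M N : Lad n} → L ≡ M → M ≈[ r ] N → L ≈[ r ] N
≡-≈ refl a = a

lad-color-agree : ∀ {r} {L M : Lad n} → L ≈[ r ] M → ∀ e → Agree r (lad-color L e) (lad-color M e)
lad-color-agree a (inj₁ va)        = rails-agree a top _
lad-color-agree a (inj₁ vb)        = rails-agree a bottom _
lad-color-agree a (inj₁ vc)        = rails-agree a top _
lad-color-agree a (inj₁ vd)        = rails-agree a bottom _
lad-color-agree a (inj₂ (rung t))  = rungs-agree a t
lad-color-agree a (inj₂ (xrail t)) = rails-agree a top _
lad-color-agree a (inj₂ (yrail t)) = rails-agree a bottom _

tail-lad : Lad (suc n) → Lad n
tail-lad L = record
  { rails  = λ s t → rails L s (suc t)
  ; rungs  = λ t → rungs L (suc t)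
  ; proper = λ s t → proper L s (suc t)
  }

-- The first rung avoids `p` and `p + x`, so it is `p - x`; the bottom side then avoids `p` and this
-- rung, so it follows the top side.
parallel-step : (L : Lad (suc n)) (p : Fin 3) → (∀ s → rails L s zero ≡ p) → ∀ x →
                rails L top 1F ≡ move x p →
                (∀ s → rails L s 1F ≡ move x p) × rungs L zero ≡ move (opposite x) p
parallel-step L p starts x next = next′ , first-rung
  where
  first-rung : rungs L zero ≡ move (opposite x) p
  first-rung = third-of-three (step-distinct x p)
    (λ e → proj₂ (proj₂ (proper L top zero)) (trans (starts top) (sym e)))
    (λ e → proj₁ (proj₂ (proper L top zero)) (trans next (sym e)))
  next′ : ∀ s → rails L s 1F ≡ move x p
  next′ top    = next
  next′ bottom = third-of-three (Distinct-rotate (Distinct-rotate (step-distinct x p)))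
    (λ e → proj₁ (proj₂ (proper L bottom zero)) (trans e (sym first-rung)))
    (λ e → proj₁ (proper L bottom zero) (trans (starts bottom) (sym e)))

parallel : (L : Lad n) (p : Fin 3) → (∀ s → rails L s zero ≡ p) → ∃ λ u → L ≗ straight p u
parallel {zero} L p starts = [] , ((λ { s zero → starts s }) , λ ())
parallel {suc n} L p starts
  with step-towards p (rails L top 1F)
         (subst (_≢ _) (starts top) (proj₁ (proper L top zero)))
... | x , q with parallel-step L p starts x q
... | next , first-rung with parallel (tail-lad L) (move x p) next
... | u , (e , e′) = x ∷ u ,
  ((λ { s zero → starts s ; s (suc t) → e s t }) ,
   (λ { zero → first-rung ; (suc t) → e′ t }))

-- The first rung avoids both starting colors, so it has color `r`. Each side then has to continue
-- with the starting color of the other, and the roles of `p` and `q` are exchanged for the rest.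
crossing : ∀ {p q r} (L : Lad n) (D : Distinct p q r) →
           rails L top zero ≡ p → rails L bottom zero ≡ q → L ≗ crossed D
crossing {zero} L D refl refl = (λ { top zero → refl ; bottom zero → refl }) , λ ()
crossing {suc n} {p} {q} {r} L D refl refl =
  (λ { top    zero → refl ; top    (suc t) → rails-equal rest top t
     ; bottom zero → refl ; bottom (suc t) → rails-equal rest bottom t })
  , (λ { zero → first-rung ; (suc t) → rungs-equal rest t })
  where
  first-rung : rungs L zero ≡ r
  first-rung = third-of-three D (≢-sym (proj₂ (proj₂ (proper L top zero))))
                                (≢-sym (proj₂ (proj₂ (proper L bottom zero))))
  next : ∀ s {a b} → Distinct a b r → rails L s zero ≡ a → rails L s 1F ≡ b
  next s D′ start = third-of-three (Distinct-rotate (Distinct-rotate D′))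
    (λ e → proj₁ (proj₂ (proper L s zero)) (trans e (sym first-rung)))
    (λ e → proj₁ (proper L s zero) (trans start (sym e)))
  rest : tail-lad L ≗ crossed (Distinct-swap D)
  rest = crossing (tail-lad L) (Distinct-swap D) (next top D refl)
                  (next bottom (Distinct-swap D) refl)

-- Listing the three copies in any order.

module Assembly {T : Fin 3 → Set} {i j k : Fin 3} (D : Distinct i j k) where

  -- With the order of the copies left free, configurations that differ by a permutation of the
  -- copies are treated as one. The computation rules below are propositional because `one-of-three`
  -- is opaque.
  assemble : T i → T j → T k → ∀ l → T l
  assemble A B C l with one-of-three D l
  ... | inj₁ refl        = A
  ... | inj₂ (inj₁ refl) = B
  ... | inj₂ (inj₂ refl) = C

  module _ {A : T i} {B : T j} {C : T k} where

    assemble-all : (P : ∀ l → T l → Set) → P i A → P j B → P k C →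
                   ∀ l → P l (assemble A B C l)
    assemble-all P a b c l with one-of-three D l
    ... | inj₁ refl        = a
    ... | inj₂ (inj₁ refl) = b
    ... | inj₂ (inj₂ refl) = c

    assemble-1 : assemble A B C i ≡ A
    assemble-1 with one-of-three D i
    ... | inj₁ refl        = refl
    ... | inj₂ (inj₁ refl) = ⊥-elim (proj₁ D refl)
    ... | inj₂ (inj₂ refl) = ⊥-elim (proj₂ (proj₂ D) refl)

    assemble-2 : assemble A B C j ≡ B
    assemble-2 with one-of-three D j
    ... | inj₁ refl        = ⊥-elim (proj₁ D refl)
    ... | inj₂ (inj₁ refl) = refl
    ... | inj₂ (inj₂ refl) = ⊥-elim (proj₁ (proj₂ D) refl)

    assemble-3 : assemble A B C k ≡ C
    assemble-3 with one-of-three D k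
    ... | inj₁ refl        = ⊥-elim (proj₂ (proj₂ D) refl)
    ... | inj₂ (inj₁ refl) = ⊥-elim (proj₁ (proj₂ D) refl)
    ... | inj₂ (inj₂ refl) = refl

    assemble-injective : (f : ∀ {l} → T l → Fin 3) → Distinct (f A) (f B) (f C) →
                         Injective₃ λ l → f (assemble A B C l)
    assemble-injective f (ab , bc , ac) {l} {m} l≢m
      with one-of-three D l | one-of-three D m
    ... | inj₁ refl        | inj₁ refl        = ⊥-elim (l≢m refl)
    ... | inj₁ refl        | inj₂ (inj₁ refl) = ab
    ... | inj₁ refl        | inj₂ (inj₂ refl) = ac
    ... | inj₂ (inj₁ refl) | inj₁ refl        = ≢-sym ab
    ... | inj₂ (inj₁ refl) | inj₂ (inj₁ refl) = ⊥-elim (l≢m refl)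
    ... | inj₂ (inj₁ refl) | inj₂ (inj₂ refl) = bc
    ... | inj₂ (inj₂ refl) | inj₁ refl        = ≢-sym ac
    ... | inj₂ (inj₂ refl) | inj₂ (inj₁ refl) = ≢-sym bc
    ... | inj₂ (inj₂ refl) | inj₂ (inj₂ refl) = ⊥-elim (l≢m refl)

open Assembly

module Configurations (n : Fin 3 → ℕ) .(nonZero : ∀ c → NonZero (n c)) where

  open Merged n nonZero public
  open Coloring

  Boundary : Lads → Set
  Boundary L = ∀ p → Injective₃ λ l → lad-color (L l) (inj₁ p)

  Boundary₃ : ∀ {i j k} → Lad (n i) → Lad (n j) → Lad (n k) → Set
  Boundary₃ A B C =
    ∀ p → Distinct (lad-color A (inj₁ p)) (lad-color B (inj₁ p)) (lad-color C (inj₁ p))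

  module _ {i j k : Fin 3} (D : Distinct i j k) where

    assembled-boundary : ∀ {A : Lad (n i)} {B : Lad (n j)} {C : Lad (n k)} →
                         Boundary₃ A B C → Boundary (assemble D A B C)
    assembled-boundary b p = assemble-injective D (λ L → lad-color L (inj₁ p)) (b p)

    assembled : (A : Lad (n i)) (B : Lad (n j)) (C : Lad (n k)) → Boundary₃ A B C → Coloring G
    assembled A B C b = paint (assemble D A B C) (assembled-boundary b)

    recolor : ∀ (L : Lads) (b : Boundary L) {A B C} (b′ : Boundary₃ A B C) r →
              L i ≈[ r ] A → L j ≈[ r ] B → L k ≈[ r ] C →
              paint L b ≃ assembled A B C b′
    recolor L b b′ r A≈ B≈ C≈ = return (r , λ { (l , e) → lad-color-agree
      (assemble-all D (λ l M → L l ≈[ r ] M) A≈ B≈ C≈ l) e })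

  as-assembled : ∀ c → ∃₂ λ (L : Lads) (b : Boundary L) → c ≃ paint L b
  as-assembled c with lads-of c
  ... | L , L≗c = L , b , return (0F , λ { (l , e) → inj₁ (sym (L≗c l e)) })
    where
    b : Boundary L
    b p {l} {m} l≢m q = pendants-distinct c p l≢m (trans (sym (L≗c l _)) (trans q (L≗c m _)))

  module _ {i j k : Fin 3} {p q r : Fin 3} (S : Distinct p q r)
           (u : Vec Step (n i)) (v : Vec Step (n j)) (w : Vec Step (n k))
           (E : Distinct (end p u) (end q v) (end r w)) where

    straight-boundary : Boundary₃ (straight p u) (straight q v) (straight r w)
    straight-boundary va = S
    straight-boundary vb = S
    straight-boundary vc rewrite walk-end p u | walk-end q v | walk-end r w = E
    straight-boundary vd rewrite walk-end p u | walk-end q v | walk-end r w = E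

    straights : Distinct i j k → Coloring G
    straights D = assembled D (straight p u) (straight q v) (straight r w) straight-boundary

  module _ {i j k : Fin 3} (D : Distinct i j k) {p q r : Fin 3} (S : Distinct p q r)
           {u : Vec Step (n i)} {v : Vec Step (n j)} {w : Vec Step (n k)}
           (E : Distinct (end p u) (end q v) (end r w)) where

    straights-recolor :
      ∀ {p′ q′ r′} (S′ : Distinct p′ q′ r′) {u′ v′ w′}
        (E′ : Distinct (end p′ u′) (end q′ v′) (end r′ w′)) a →
      straight p u ≈[ a ] straight p′ u′ → straight q v ≈[ a ] straight q′ v′ →
      straight r w ≈[ a ] straight r′ w′ →
      straights S u v w E D ≃ straights S′ u′ v′ w′ E′ D
    straights-recolor S′ E′ a A≈ B≈ C≈ =
      recolor D _ (assembled-boundary D (straight-boundary S u v w E))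
        (straight-boundary S′ _ _ _ E′) a
        (≡-≈ (assemble-1 D) A≈) (≡-≈ (assemble-2 D) B≈) (≡-≈ (assemble-3 D) C≈)

    -- Only the listing of the copies changes, not any color; every class is common, and `0F` is an
    -- arbitrary choice.
    straights-rotate : straights S u v w E D ≃
      straights (Distinct-rotate S) v w u (Distinct-rotate E) (Distinct-rotate D)
    straights-rotate =
      recolor (Distinct-rotate D) _ (assembled-boundary D (straight-boundary S u v w E))
        (straight-boundary (Distinct-rotate S) v w u (Distinct-rotate E)) 0F
        (≡-≈ (assemble-2 D) ≈-refl) (≡-≈ (assemble-3 D) ≈-refl) (≡-≈ (assemble-1 D) ≈-refl)

    straights-swap : straights S u v w E D ≃
      straights (Distinct-swap S) v u w (Distinct-swap E) (Distinct-swap D)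
    straights-swap =
      recolor (Distinct-swap D) _ (assembled-boundary D (straight-boundary S u v w E))
        (straight-boundary (Distinct-swap S) v u w (Distinct-swap E)) 0F
        (≡-≈ (assemble-2 D) ≈-refl) (≡-≈ (assemble-1 D) ≈-refl) (≡-≈ (assemble-3 D) ≈-refl)

012-distinct : Distinct {Fin 3} 0F 1F 2F
012-distinct = (λ ()) , (λ ()) , (λ ())

021-distinct : Distinct {Fin 3} 0F 2F 1F
021-distinct = (λ ()) , (λ ()) , (λ ())

-- Straightening the crossed copies.

alternate : Step → ∀ n → Vec Step n
alternate x zero    = []
alternate x (suc n) = x ∷ alternate (opposite x) n

walk-alternate : ∀ x p (t : Fin (suc n)) → walk p (alternate x n) t ≡ alternation p (move x p) t
walk-alternate         x p zero    = refl
walk-alternate {suc n} x p (suc t) = trans (walk-alternate (opposite x) (move x p) t)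
  (cong (λ q → alternation (move x p) q t) (move-back x p))

walk-rungs-alternate : ∀ x p (t : Fin n) → walk-rungs p (alternate x n) t ≡ move (opposite x) p
walk-rungs-alternate x p zero    = refl
walk-rungs-alternate x p (suc t) = trans (walk-rungs-alternate (opposite x) (move x p) t)
  (trans (cong (λ y → move y (move x p)) (opposite-involutive x)) (move-twice x p))

-- The rungs of `crossed D` are exactly its class `r`. Exchanging `p` and `q` on the bottom side
-- keeps that class and makes both sides the same alternating walk.
crossed-straight : ∀ {p q r} (D : Distinct p q r) → ∃ λ u →
                   crossed {n} D ≈[ r ] straight p u × (∀ t → walk p u t ≡ alternation p q t)
crossed-straight {n} {p} {q} {r} D with step-towards p q (proj₁ D)
... | x , refl = alternate x n , ( (λ { top t    → inj₁ (sym (walk-alternate x p t))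
       ; bottom t → inj₂ (alternation-≢ q≢r p≢r t ,
           subst (_≢ r) (sym (walk-alternate x p t)) (alternation-≢ p≢r q≢r t)) })
  , (λ t → inj₁ (trans
      (sym (third-of-three D (≢-sym (proj₂ (proj₂ (step-distinct x p))))
                             (≢-sym (proj₁ (proj₂ (step-distinct x p))))))
      (sym (walk-rungs-alternate x p t)))) ) ,
  walk-alternate x p
  where
  p≢r = proj₂ (proj₂ D)
  q≢r = proj₁ (proj₂ D)

alternation-agree : ∀ {a p p′ q q′} → Agree a p p′ → Agree a q q′ → (t : Fin (suc n)) →
                    Agree a (alternation p q t) (alternation p′ q′ t)
alternation-agree         α β zero    = α
alternation-agree {suc n} α β (suc t) = alternation-agree β α t

≗-refl : {L : Lad n} → L ≗ L
≗-refl = (λ _ _ → refl) , (λ _ → refl)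

≡⇒≗ : {L M : Lad n} → L ≡ M → L ≗ M
≡⇒≗ refl = ≗-refl

≗⇒≈ : ∀ {r} {L M : Lad n} → L ≗ M → L ≈[ r ] M
≗⇒≈ e = ≗-≈ e ≈-refl

module Straightening (n : Fin 3 → ℕ) .(nonZero : ∀ c → NonZero (n c))
                     (h : Fin 3 → ℕ) (n≡2h : ∀ l → n l ≡ h l * 2) where

  open Configurations n nonZero public
  open Coloring

  data Straightened (c : Coloring G) : Set where
    straightened : ∀ {i j k} (D : Distinct i j k) {p q r} (S : Distinct p q r) {u v w}
                   (E : Distinct (end p u) (end q v) (end r w)) →
                   c ≃ straights S u v w E D → Straightened c

  straight-last : ∀ {l} {L : Lad (n l)} {p u} → L ≗ straight p u →
                  lad-color L (inj₁ vc) ≡ end p u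
  straight-last {p = p} {u} (e , _) = trans (e top _) (walk-end p u)

  crossed-last : ∀ {l} {L : Lad (n l)} {p q r} (D : Distinct p q r) → L ≗ crossed D →
                 lad-color L (inj₁ vc) ≡ p
  crossed-last {l} D (e , _) = trans (e top _) (alternation-end (h l) (n≡2h l) _ _)

  alternating-end : ∀ l {p q} {u : Vec Step (n l)} → (∀ t → walk p u t ≡ alternation p q t) →
                    end p u ≡ p
  alternating-end l {p} {q} {u} e = trans (sym (walk-end p u))
    (trans (e (fromℕ (n l))) (alternation-end (h l) (n≡2h l) p q))

  distinct-pendants : ∀ {i j k} (L : Lads) → Boundary L → Distinct i j k → Boundary₃ (L i) (L j) (L k)
  distinct-pendants L b (ij , jk , ik) p = b p ij , b p jk , b p ik

  Distinct-subst : ∀ {p q r p′ q′ r′ : Fin 3} → p ≡ p′ → q ≡ q′ → r ≡ r′ →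
                   Distinct p q r → Distinct p′ q′ r′
  Distinct-subst refl refl refl D = D

  three-straight : ∀ {i j k} (L : Lads) (b : Boundary L) (D : Distinct i j k)
                   {p q r} (S : Distinct p q r) {u v w} →
                   L i ≗ straight p u → L j ≗ straight q v → L k ≗ straight r w →
                   Straightened (paint L b)
  three-straight L b D S {u} {v} {w} A B C = straightened D S E
    (recolor D L b (straight-boundary S u v w E) 0F (≗⇒≈ A) (≗⇒≈ B) (≗⇒≈ C))
    where
    E = Distinct-subst (straight-last A) (straight-last B) (straight-last C)
          (distinct-pendants L b D vc)

  -- In both crossed copies class `p` consists of the rungs, so they are straightened together while
  -- class `p` stays fixed in the whole graph. By even length the alternating walks end where they
  -- start, so the right ends still match.
  one-straight : ∀ {i j k} (L : Lads) (b : Boundary L) (D : Distinct i j k)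
                 {p q r} (S : Distinct p q r)
                 (Q : Distinct q r p) (R : Distinct r q p) {u} →
                 L i ≗ straight p u → L j ≗ crossed Q → L k ≗ crossed R →
                 Straightened (paint L b)
  one-straight {i} {j} {k} L b D {p} {q} {r} S Q R {u} A B C
    with crossed-straight {n j} Q | crossed-straight {n k} R
  ... | v , Q≈ , v-alternates | w , R≈ , w-alternates = straightened D S E
    (recolor D L b (straight-boundary S u v w E) p (≗⇒≈ A) (≗-≈ B Q≈) (≗-≈ C R≈))
    where
    E = Distinct-subst (straight-last A)
          (trans (crossed-last Q B) (sym (alternating-end j v-alternates)))
          (trans (crossed-last R C) (sym (alternating-end k w-alternates)))
          (distinct-pendants L b D vc)

  -- One recoloring that keeps class `r` leads to `one-straight`: it exchanges `p` and `q` on the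
  -- bottom side of copy `i` and everywhere in copy `k`.
  all-crossed : ∀ {i j k} (L : Lads) (b : Boundary L) (D : Distinct i j k)
                {p q r} (P : Distinct p q r) →
                L i ≗ crossed P → L j ≗ crossed (Distinct-rotate P) →
                L k ≗ crossed (Distinct-rotate (Distinct-rotate P)) →
                Straightened (paint L b)
  all-crossed {i} {j} {k} L b D {p} {q} {r} P@(p≢q , q≢r , p≢r) A B C
    with crossed-straight {n i} P
  ... | u , P≈ , u-alternates
    = via (one-straight M (assembled-boundary D boundary) D P Q R
             (≡⇒≗ (assemble-1 D)) (≡⇒≗ (assemble-2 D)) (≡⇒≗ (assemble-3 D)))
    where
    Q : Distinct q r p
    Q = Distinct-rotate P
    R : Distinct r q p
    R = Distinct-swap Q
    M : Lads
    M = assemble D (straight p u) (crossed Q) (crossed R)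
    boundary : Boundary₃ {i} {j} {k} (straight p u) (crossed Q) (crossed R)
    boundary va = P
    boundary vb = p≢r , ≢-sym q≢r , p≢q
    boundary vc rewrite walk-end p u | alternating-end i u-alternates
      | alternation-end (h j) (n≡2h j) q r | alternation-end (h k) (n≡2h k) r q = P
    boundary vd rewrite walk-end p u | alternating-end i u-alternates
      | alternation-end (h j) (n≡2h j) r q | alternation-end (h k) (n≡2h k) q r =
      p≢r , ≢-sym q≢r , p≢q
    third : crossed (Distinct-rotate Q) ≈[ r ] crossed R
    third = (λ { top t → alternation-agree (inj₁ refl) (inj₂ (p≢r , q≢r)) t
               ; bottom t → alternation-agree (inj₂ (p≢r , q≢r)) (inj₁ refl) t })
          , (λ _ → inj₂ (q≢r , p≢r))
    via : Straightened (paint M (assembled-boundary D boundary)) → Straightened (paint L b)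
    via (straightened D′ S E M≃) = straightened D′ S E
      (recolor D L b boundary r (≗-≈ A P≈) (≗⇒≈ B) (≗-≈ C third) ◅◅ M≃)

  module Classification (L : Lads) (b : Boundary L) where

    start start′ : Fin 3 → Fin 3
    start  l = rails (L l) top zero
    start′ l = rails (L l) bottom zero

    starts : ∀ {i j k} → Distinct i j k → Distinct (start i) (start j) (start k)
    starts D = distinct-pendants L b D va

    word : ∀ l → start′ l ≡ start l → ∃ λ u → L l ≗ straight (start l) u
    word l p = parallel (L l) _ λ { top → refl ; bottom → p }

    cross : ∀ l {q r} (D : Distinct (start l) q r) → start′ l ≡ q → L l ≗ crossed D
    cross l D q = crossing (L l) D refl q

    one : ∀ {i j k} (D : Distinct i j k) →
          start′ i ≡ start i → start′ j ≡ start k → start′ k ≡ start j → Straightened (paint L b)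
    one D p q r = one-straight L b D S Q R (proj₂ (word _ p)) (cross _ Q q) (cross _ R r)
      where
      S = starts D
      Q = Distinct-rotate S
      R = Distinct-swap Q

    all : ∀ {i j k} (D : Distinct i j k) →
          start′ i ≡ start j → start′ j ≡ start k → start′ k ≡ start i → Straightened (paint L b)
    all D p q r = all-crossed L b D S
      (cross _ S p) (cross _ (Distinct-rotate S) q)
      (cross _ (Distinct-rotate (Distinct-rotate S)) r)
      where S = starts D

    other : ∀ {l m q} → l ≢ m → start′ l ≡ q → start′ m ≢ q
    other l≢m p q = distinct-bottoms l≢m (trans p (sym q))
      where
      distinct-bottoms : Injective₃ start′
      distinct-bottoms = b vb

    -- At the left end, sending the top pendant color of a copy to its bottom one is a permutation
    -- of the colors: the identity, a transposition or a 3-cycle. These are the cases of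
    -- `three-straight`, `one` and `all`.
    paint-straightened : Straightened (paint L b)
    paint-straightened with start′ 0F ≟ start 0F | start′ 1F ≟ start 1F | start′ 2F ≟ start 2F
    ... | yes p | yes q | _ = three-straight L b 012-distinct S
      (proj₂ (word 0F p)) (proj₂ (word 1F q))
      (proj₂ (word 2F (third-of-three S (other (λ ()) p) (other (λ ()) q))))
      where S = starts 012-distinct
    ... | yes p | no q | _ = one 012-distinct p q′
      (third-of-three (starts 021-distinct) (other (λ ()) p) (other (λ ()) q′))
      where q′ = third-of-three (starts 012-distinct) (other (λ ()) p) q
    ... | no p | yes q | _ = one (Distinct-rotate 012-distinct) q
      (third-of-three (Distinct-rotate (starts 012-distinct)) (other (λ ()) q) (other (λ ()) p′)) p′
      where p′ = third-of-three (starts 012-distinct) p (other (λ ()) q)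
    ... | no p | no q | yes r = one (Distinct-rotate (Distinct-rotate 012-distinct)) r
      (third-of-three (Distinct-rotate (Distinct-rotate (starts 012-distinct))) (other (λ ()) r) p)
      (third-of-three (Distinct-rotate (starts 012-distinct)) q (other (λ ()) r))
    ... | no p | no q | no r with one-of-three (starts 012-distinct) (start′ 0F)
    ... | inj₁ p′        = ⊥-elim (p p′)
    ... | inj₂ (inj₁ p′) = all 012-distinct p′
      (third-of-three (starts 012-distinct) (other (λ ()) r′) q) r′
      where r′ = third-of-three (Distinct-rotate (starts 012-distinct)) (other (λ ()) p′) r
    -- The inverse 3-cycle takes the same form when the copies are listed as 0, 2, 1.
    ... | inj₂ (inj₂ p′) = all 021-distinct p′
      (third-of-three (Distinct-rotate (Distinct-rotate (starts 012-distinct))) r (other (λ ()) q′)) q′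
      where q′ = third-of-three (Distinct-rotate (starts 012-distinct)) q (other (λ ()) p′)

  straighten : ∀ c → Straightened c
  straighten c with as-assembled c
  ... | L , b , c≃L with Classification.paint-straightened L b
  ... | straightened D S E M≃ = straightened D S E (c≃L ◅◅ M≃)

-- Recolorings at the start of a walk.

≈-sym : ∀ {r} {L M : Lad n} → L ≈[ r ] M → M ≈[ r ] L
≈-sym (a , a′) = (λ s t → Agree-sym (a s t)) , (λ t → Agree-sym (a′ t))

straight-∷ : ∀ {a x y p p′} {u v : Vec Step n} → Agree a p p′ →
             Agree a (move (opposite x) p) (move (opposite y) p′) →
             straight (move x p) u ≈[ a ] straight (move y p′) v →
             straight p (x ∷ u) ≈[ a ] straight p′ (y ∷ v)
straight-∷ α β (γ , δ) = (λ { s zero → α ; s (suc t) → γ s t }) ,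
                         (λ { zero → β ; (suc t) → δ t })

avoiding : ∀ {a p q} {p≢a : True (¬? (p ≟ a))} {q≢a : True (¬? (q ≟ a))} → Agree a p q
avoiding {p≢a = p≢a} {q≢a} = inj₂ (toWitness p≢a , toWitness q≢a)

-- After one step both walks are at `p - x`, the color of the common class. Before that, the
-- starting color and the first rung trade `p` and `p + x`.
single-agree : ∀ x p (u : Vec Step n) →
               straight p (opposite x ∷ u) ≈[ move (opposite x) p ] straight (move x p) (x ∷ u)
single-agree ⊕ 0F u = straight-∷ avoiding avoiding ≈-refl
single-agree ⊕ 1F u = straight-∷ avoiding avoiding ≈-refl
single-agree ⊕ 2F u = straight-∷ avoiding avoiding ≈-refl
single-agree ⊖ 0F u = straight-∷ avoiding avoiding ≈-refl
single-agree ⊖ 1F u = straight-∷ avoiding avoiding ≈-refl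
single-agree ⊖ 2F u = straight-∷ avoiding avoiding ≈-refl

-- One walk starts `p`, `p + x`, `p - x`, the other `p + x`, `p`, `p - x`: until they meet, `p` and
-- `p + x` are exchanged.
double-agree : ∀ x p (u : Vec Step n) →
               straight p (x ∷ x ∷ u) ≈[ move (opposite x) p ]
               straight (move x p) (opposite x ∷ opposite x ∷ u)
double-agree ⊕ 0F u =
  straight-∷ avoiding (inj₁ refl) (straight-∷ avoiding avoiding ≈-refl)
double-agree ⊕ 1F u =
  straight-∷ avoiding (inj₁ refl) (straight-∷ avoiding avoiding ≈-refl)
double-agree ⊕ 2F u =
  straight-∷ avoiding (inj₁ refl) (straight-∷ avoiding avoiding ≈-refl)
double-agree ⊖ 0F u =
  straight-∷ avoiding (inj₁ refl) (straight-∷ avoiding avoiding ≈-refl)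
double-agree ⊖ 1F u =
  straight-∷ avoiding (inj₁ refl) (straight-∷ avoiding avoiding ≈-refl)
double-agree ⊖ 2F u =
  straight-∷ avoiding (inj₁ refl) (straight-∷ avoiding avoiding ≈-refl)

-- For opposite `x` and `y` the walk leaves `p` and returns, so the first two rungs and the two
-- rails between them form a 4-cycle in the other two colors, which is switched.
exchange-agree : ∀ x y p (u : Vec Step n) →
                 straight p (x ∷ y ∷ u) ≈[ p ] straight p (y ∷ x ∷ u)
exchange-agree ⊕ ⊕ p u = ≈-refl
exchange-agree ⊖ ⊖ p u = ≈-refl
exchange-agree ⊕ ⊖ 0F u =
  straight-∷ (inj₁ refl) avoiding (straight-∷ avoiding avoiding ≈-refl)
exchange-agree ⊕ ⊖ 1F u =
  straight-∷ (inj₁ refl) avoiding (straight-∷ avoiding avoiding ≈-refl)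
exchange-agree ⊕ ⊖ 2F u =
  straight-∷ (inj₁ refl) avoiding (straight-∷ avoiding avoiding ≈-refl)
exchange-agree ⊖ ⊕ 0F u =
  straight-∷ (inj₁ refl) avoiding (straight-∷ avoiding avoiding ≈-refl)
exchange-agree ⊖ ⊕ 1F u =
  straight-∷ (inj₁ refl) avoiding (straight-∷ avoiding avoiding ≈-refl)
exchange-agree ⊖ ⊕ 2F u =
  straight-∷ (inj₁ refl) avoiding (straight-∷ avoiding avoiding ≈-refl)

-- Reordering the steps of a word.

infix 4 _⇄_ _⇄*_
data _⇄_ : Vec Step n → Vec Step n → Set where
  exchange : ∀ x y (u : Vec Step n) → x ∷ y ∷ u ⇄ y ∷ x ∷ u
  keep     : ∀ x {u v : Vec Step n} → u ⇄ v → x ∷ u ⇄ x ∷ v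

_⇄*_ : Vec Step n → Vec Step n → Set
_⇄*_ = Star _⇄_

⇄-agree : {u v : Vec Step n} → u ⇄ v → ∀ p → ∃ λ r → straight p u ≈[ r ] straight p v
⇄-agree (exchange x y u) p = p , exchange-agree x y p u
⇄-agree (keep x e) p with ⇄-agree e (move x p)
... | r , a = r , straight-∷ (inj₁ refl) (inj₁ refl) a

move-commute : ∀ x y p → move x (move y p) ≡ move y (move x p)
move-commute ⊕ ⊕ p = refl
move-commute ⊖ ⊖ p = refl
move-commute ⊕ ⊖ p = trans (move-back ⊖ p) (sym (move-back ⊕ p))
move-commute ⊖ ⊕ p = trans (move-back ⊕ p) (sym (move-back ⊖ p))

⇄-end : {u v : Vec Step n} → u ⇄ v → ∀ p → end p u ≡ end p v
⇄-end (exchange x y u) p = cong (λ q → end q u) (move-commute y x p)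
⇄-end (keep x e)       p = ⇄-end e (move x p)

⇄*-end : {u v : Vec Step n} → u ⇄* v → ∀ p → end p u ≡ end p v
⇄*-end ε        p = refl
⇄*-end (e ◅ es) p = trans (⇄-end e p) (⇄*-end es p)

tally : Step → Step → ℕ
tally ⊕ ⊕ = 1
tally ⊖ ⊖ = 1
tally ⊕ ⊖ = 0
tally ⊖ ⊕ = 0

tally-same : ∀ x → tally x x ≡ 1
tally-same ⊕ = refl
tally-same ⊖ = refl

count : Step → Vec Step n → ℕ
count x []      = 0
count x (y ∷ u) = tally x y + count x u

⇄-count : {u v : Vec Step n} → u ⇄ v → ∀ z → count z u ≡ count z v
⇄-count (exchange x y u) z = trans (sym (+-assoc (tally z x) (tally z y) (count z u)))
  (trans (cong (_+ count z u) (+-comm (tally z x) (tally z y)))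
         (+-assoc (tally z y) (tally z x) (count z u)))
⇄-count (keep x e) z = cong (λ m → tally z x + m) (⇄-count e z)

⇄*-count : {u v : Vec Step n} → u ⇄* v → ∀ z → count z u ≡ count z v
⇄*-count ε        z = refl
⇄*-count (e ◅ es) z = trans (⇄-count e z) (⇄*-count es z)

bring : ∀ x (u : Vec Step (suc n)) {m} → count x u ≡ suc m → ∃ λ u′ → u ⇄* x ∷ u′
bring-past : ∀ x y (u : Vec Step n) {m} → count x u ≡ suc m → ∃ λ u′ → y ∷ u ⇄* x ∷ u′
bring ⊕ (⊕ ∷ u) q = u , ε
bring ⊖ (⊖ ∷ u) q = u , ε
bring ⊕ (⊖ ∷ u) q = bring-past ⊕ ⊖ u q
bring ⊖ (⊕ ∷ u) q = bring-past ⊖ ⊕ u q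
bring-past x y u@(_ ∷ _) q with bring x u q
... | u′ , e = y ∷ u′ , gmap (y ∷_) (keep y) e ◅◅ return (exchange y x u′)

-- Sorting by adjacent exchanges: the first letter of `v` also occurs in `u` and is brought to the
-- front; the remaining letters again have equal counts.
same-count : (u v : Vec Step n) → (∀ x → count x u ≡ count x v) → u ⇄* v
same-count []      []      q = ε
same-count u@(_ ∷ _) (x ∷ v) q
  with bring x u (trans (q x) (cong (_+ count x v) (tally-same x)))
... | u′ , e = e ◅◅ gmap (x ∷_) (keep x) (same-count u′ v λ z →
  +-cancelˡ-≡ (tally z x) _ _ (trans (sym (⇄*-count e z)) (q z)))

count-alternate : ∀ {n} h → n ≡ h * 2 → ∀ x z → count z (alternate x n) ≡ h
count-alternate zero    refl x z = refl
count-alternate (suc h) refl ⊕ ⊕ = cong suc (count-alternate h refl ⊕ ⊕)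
count-alternate (suc h) refl ⊕ ⊖ = cong suc (count-alternate h refl ⊕ ⊖)
count-alternate (suc h) refl ⊖ ⊕ = cong suc (count-alternate h refl ⊖ ⊕)
count-alternate (suc h) refl ⊖ ⊖ = cong suc (count-alternate h refl ⊖ ⊖)

-- The tilt of a word.

deficit excess : ℤ → ℕ
deficit (+ _)    = 0
deficit -[1+ a ] = suc a
excess  (+ a)    = a
excess  -[1+ _ ] = 0

raise lower : ℤ → ℤ
raise (+ a)          = + suc a
raise -[1+ zero ]    = +0
raise -[1+ suc a ]   = -[1+ a ]
lower +0             = -[1+ 0 ]
lower +[1+ a ]       = + a
lower -[1+ a ]       = -[1+ suc a ]

raise-balance : ∀ {c h} δ → c + deficit δ ≡ h + excess δ →
                suc c + deficit (raise δ) ≡ h + excess (raise δ)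
raise-balance {c} {h} (+ a)        q = trans (cong suc q) (sym (+-suc h a))
raise-balance {c} {h} -[1+ zero ]  q = trans (sym (+-suc c 0)) q
raise-balance {c} {h} -[1+ suc a ] q = trans (sym (+-suc c (suc a))) q

lower-balance : ∀ {c h} δ → suc c + deficit δ ≡ h + excess δ →
                c + deficit (lower δ) ≡ h + excess (lower δ)
lower-balance {c} {h} +0       q = trans (+-suc c 0) q
lower-balance {c} {h} +[1+ a ] q = suc-injective (trans q (+-suc h a))
lower-balance {c} {h} -[1+ a ] q = trans (+-suc c (suc a)) q

raise-neg : ∀ δ → - raise δ ≡ lower (- δ)
raise-neg +0           = refl
raise-neg +[1+ a ]     = refl
raise-neg -[1+ zero ]  = refl
raise-neg -[1+ suc a ] = refl

lower-neg : ∀ δ → - lower δ ≡ raise (- δ)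
lower-neg +0           = refl
lower-neg +[1+ zero ]  = refl
lower-neg +[1+ suc a ] = refl
lower-neg -[1+ a ]     = refl

-- This is `c = m + δ` kept within ℕ: `deficit δ` and `excess δ` are the negative and the positive
-- part of `δ`.
Balance : ℕ → ℕ → ℤ → Set
Balance c m δ = c + deficit δ ≡ m + excess δ

-- The word u has m + δ steps x and m - δ opposite steps.
record Tilt (m : ℕ) (x : Step) (u : Vec Step n) (δ : ℤ) : Set where
  constructor _,_
  field
    along   : Balance (count x u) m δ
    against : Balance (count (opposite x) u) m (- δ)

open Tilt

Tilt-reverse : ∀ {m x δ} {u : Vec Step n} → Tilt m x u δ → Tilt m (opposite x) u (- δ)
Tilt-reverse {m = m} {x} {δ} {u} (a , b) = b ,
  subst₂ (λ y ε → Balance (count y u) m ε) (sym (opposite-involutive x)) (sym (neg-involutive δ)) a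

Tilt-⇄* : ∀ {m x δ} {u v : Vec Step n} → u ⇄* v → Tilt m x u δ → Tilt m x v δ
Tilt-⇄* {m = m} {x} {δ} e (a , b) =
  subst (λ c → Balance c m δ) (⇄*-count e x) a ,
  subst (λ c → Balance c m (- δ)) (⇄*-count e (opposite x)) b

Tilt-raise : ∀ {m} x {δ} {u : Vec Step n} →
             Tilt m x (opposite x ∷ u) δ → Tilt m x (x ∷ u) (raise δ)
Tilt-raise {m = m} ⊕ {δ} {u} (a , b) = raise-balance δ a ,
  subst (Balance (count ⊖ u) m) (sym (raise-neg δ)) (lower-balance (- δ) b)
Tilt-raise {m = m} ⊖ {δ} {u} (a , b) = raise-balance δ a ,
  subst (Balance (count ⊕ u) m) (sym (raise-neg δ)) (lower-balance (- δ) b)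

Tilt-lower : ∀ {m} x {δ} {u : Vec Step n} →
             Tilt m x (x ∷ u) δ → Tilt m x (opposite x ∷ u) (lower δ)
Tilt-lower {m = m} ⊕ {δ} {u} (a , b) = lower-balance δ a ,
  subst (Balance (suc (count ⊖ u)) m) (sym (lower-neg δ)) (raise-balance (- δ) b)
Tilt-lower {m = m} ⊖ {δ} {u} (a , b) = lower-balance δ a ,
  subst (Balance (suc (count ⊕ u)) m) (sym (lower-neg δ)) (raise-balance (- δ) b)

+-exchange : ∀ a b c → a + (b + c) ≡ b + (a + c)
+-exchange a b c = trans (sym (+-assoc a b c)) (trans (cong (_+ c) (+-comm a b)) (+-assoc b a c))

-- As `c + d = 2m`, the deviations of `c` and `d` from `m` are opposite.
balances : ∀ c d m → c + d ≡ m + m → ∃ λ δ → Balance c m δ × Balance d m (- δ)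
balances c d m q with compare c m
... | less c k = -[1+ k ] , trans (+-suc c k) (sym (+-identityʳ _)) ,
  trans (+-identityʳ d) (+-cancelˡ-≡ c d _
    (trans q (trans (cong (λ a → suc (c + k) + a) (sym (+-suc c k)))
                    (+-exchange (suc (c + k)) c (suc k)))))
... | equal c = +0 , refl , cong (_+ 0) (+-cancelˡ-≡ c d c q)
... | greater m k = +[1+ k ] , trans (+-identityʳ _) (sym (+-suc m k)) ,
  trans (+-cancelˡ-≡ m (d + suc k) m (trans
    (trans (cong (λ a → m + a) (+-comm d (suc k)))
      (trans (sym (+-assoc m (suc k) d)) (cong (_+ d) (+-suc m k)))) q))
    (sym (+-identityʳ m))

count-total : ∀ x (u : Vec Step n) → count x u + count (opposite x) u ≡ n
count-total x []      = refl
count-total x (y ∷ u) = 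
  trans (both x y (count x u) (count (opposite x) u)) (cong suc (count-total x u))
  where
  both : ∀ x y a b → (tally x y + a) + (tally (opposite x) y + b) ≡ suc (a + b)
  both ⊕ ⊕ a b = refl
  both ⊖ ⊖ a b = refl
  both ⊕ ⊖ a b = +-suc a b
  both ⊖ ⊕ a b = +-suc a b

tilt : ∀ m → n ≡ m * 2 → ∀ x (u : Vec Step n) → ∃ λ δ → Tilt m x u δ
tilt m n≡2m x u
  with balances (count x u) (count (opposite x) u) m
         (trans (count-total x u)
           (trans n≡2m (trans (*-comm m 2) (cong (λ a → m + a) (+-identityʳ m)))))
... | δ , a , b = δ , (a , b)

level-alternate : ∀ {m x y} {u : Vec Step n} → n ≡ m * 2 → Tilt m x u +0 → u ⇄* alternate y n
level-alternate {m = m} {x} {y} {u} n≡2m (a , b) = same-count u _ λ z →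
  trans (counts z) (sym (count-alternate m n≡2m y z))
  where
  half : ∀ {c} → c + 0 ≡ m + 0 → c ≡ m
  half {c} q = trans (sym (+-identityʳ c)) (trans q (+-identityʳ m))
  counts : ∀ z → count z u ≡ m
  counts z = by-cases x z a b
    where
    by-cases : ∀ x z → count x u + 0 ≡ m + 0 → count (opposite x) u + 0 ≡ m + 0 → count z u ≡ m
    by-cases ⊕ ⊕ a b = half a
    by-cases ⊕ ⊖ a b = half b
    by-cases ⊖ ⊕ a b = half b
    by-cases ⊖ ⊖ a b = half a

alternate-end : ∀ {n} m → n ≡ m * 2 → ∀ x p → end p (alternate x n) ≡ p
alternate-end zero    refl x p = refl
alternate-end (suc m) refl x p = trans
  (cong (λ q → end q (alternate (opposite (opposite x)) (m * 2))) (move-back x p))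
  (alternate-end m refl (opposite (opposite x)) p)

level-end : ∀ {m x} {u : Vec Step n} → n ≡ m * 2 → Tilt m x u +0 → ∀ p → end p u ≡ p
level-end {m = m} {x} n≡2m t p =
  trans (⇄*-end (level-alternate {y = ⊕} n≡2m t) p) (alternate-end m n≡2m ⊕ p)

-- Changing the starting color of one copy.

record Recolored (m : ℕ) (x : Step) (r : Fin 3) (p : Fin 3) (u : Vec Step n)
                 (p′ : Fin 3) (δ : ℤ) : Set where
  field
    {before after} : Vec Step n
    reordered      : u ⇄* before
    agree          : straight p before ≈[ r ] straight p′ after
    same-end       : end p u ≡ end p′ after
    new-tilt       : Tilt m x after δ

open Recolored

unchanged : ∀ {m x r p δ} {u : Vec Step n} → Tilt m x u δ → Recolored m x r p u p δ
unchanged t = record { reordered = ε ; agree = ≈-refl ; same-end = refl ; new-tilt = t }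

-- A step `opposite x` is brought to the front, and `single-agree` turns it into `x`.
raised : ∀ {m} x p {u : Vec Step n} {δ c} → count (opposite x) u ≡ suc c → Tilt m x u δ →
         Recolored m x (move (opposite x) p) p u (move x p) (raise δ)
raised x p {u@(_ ∷ _)} q t with bring (opposite x) u q
... | u′ , e = record
  { reordered = e
  ; agree     = single-agree x p u′
  ; same-end  = trans (⇄*-end e p) (cong (λ z → end z u′) (sym (move-twice x p)))
  ; new-tilt  = Tilt-raise x (Tilt-⇄* e t)
  }

lowered : ∀ {m} x p {u : Vec Step n} {δ c} → count x u ≡ suc c → Tilt m x u δ →
          Recolored m x (move (opposite x) p) (move x p) u p (lower δ)
lowered x p {u@(_ ∷ _)} q t with bring x u q
... | u′ , e = record
  { reordered = e
  ; agree     = ≈-sym (single-agree x p u′)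
  ; same-end  = trans (⇄*-end e (move x p)) (cong (λ z → end z u′) (move-twice x p))
  ; new-tilt  = Tilt-lower x (Tilt-⇄* e t)
  }

-- Moves the start as `raised` does and keeps the same class, but flips two steps `x` by
-- `double-agree` where `raised` flips one opposite step.
lowered-twice : ∀ {m} x p {u : Vec Step n} {δ c} → count x u ≡ suc (suc c) → Tilt m x u δ →
                Recolored m x (move (opposite x) p) p u (move x p) (lower (lower δ))
lowered-twice x p {u@(_ ∷ [])} q t = ⊥-elim (short x _ q)
  where
  short : ∀ x y {c} → tally x y + 0 ≢ suc (suc c)
  short ⊕ ⊕ ()
  short ⊕ ⊖ ()
  short ⊖ ⊕ ()
  short ⊖ ⊖ ()
lowered-twice x p {u@(_ ∷ _ ∷ _)} q t with bring x u q
... | u′ , e with bring x u′ (suc-injective (trans (cong (_+ count x u′) (sym (tally-same x)))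
                    (trans (sym (⇄*-count e x)) q)))
... | u″ , e′ = record
  { reordered = e″
  ; agree     = double-agree x p u″
  ; same-end  = trans (⇄*-end e″ p) (cong (λ z → end z u″) turn)
  -- `Tilt-lower` flips a leading `x` only, so after the first flip the second `x` is exchanged to
  -- the front.
  ; new-tilt  = Tilt-lower x
      (Tilt-⇄* (return (exchange (opposite x) x u″)) (Tilt-lower x (Tilt-⇄* e″ t)))
  }
  where
  e″ = e ◅◅ gmap (x ∷_) (keep x) e′
  turn : move x (move x p) ≡ move (opposite x) (move (opposite x) (move x p))
  turn = trans (move-twice x p) (cong (move (opposite x)) (sym (move-back x p)))

-- The reflection `p ↦ 2a - p` of ℤ/3, that is, the transposition of colors that fixes `a`. It
-- reverses steps.
reflect : Fin 3 → Fin 3 → Fin 3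
reflect a = transpose (up a) (dn a)

reflect-involutive : ∀ a p → reflect a (reflect a p) ≡ p
reflect-involutive = from-yes
  (all? λ (a : Fin 3) → all? λ (p : Fin 3) → reflect a (reflect a p) ≟ p)

reflect-agree : ∀ a p → Agree a p (reflect a p)
reflect-agree = from-yes (all? λ (a : Fin 3) → all? λ (p : Fin 3) →
  (p ≟ reflect a p) ⊎-dec (¬? (p ≟ a) ×-dec ¬? (reflect a p ≟ a)))

reflect-move : ∀ x a p → reflect a (move x p) ≡ move (opposite x) (reflect a p)
reflect-move ⊕ = from-yes
  (all? λ (a : Fin 3) → all? λ (p : Fin 3) → reflect a (up p) ≟ dn (reflect a p))
reflect-move ⊖ = from-yes
  (all? λ (a : Fin 3) → all? λ (p : Fin 3) → reflect a (dn p) ≟ up (reflect a p))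

Distinct-reflect : ∀ a {p q r} → Distinct p q r → Distinct (reflect a p) (reflect a q) (reflect a r)
Distinct-reflect a (p≢q , q≢r , p≢r) = p≢q ∘ injective , q≢r ∘ injective , p≢r ∘ injective
  where
  injective : ∀ {p q} → reflect a p ≡ reflect a q → p ≡ q
  injective {p} {q} e =
    trans (sym (reflect-involutive a p)) (trans (cong (reflect a) e) (reflect-involutive a q))

alternate-reflect : ∀ n a x p →
  straight p (alternate x n) ≈[ a ] straight (reflect a p) (alternate (opposite x) n)
alternate-reflect zero    a x p = (λ { s zero → reflect-agree a p }) , λ ()
alternate-reflect (suc n) a x p = straight-∷ (reflect-agree a p)
  (subst (Agree a (move (opposite x) p)) (reflect-move (opposite x) a p)
    (reflect-agree a (move (opposite x) p)))
  (subst (λ q → straight (move x p) (alternate (opposite x) n) ≈[ a ]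
                straight q (alternate (opposite (opposite x)) n))
    (reflect-move x a p) (alternate-reflect n a (opposite x) (move x p)))

-- In general a walk from `p` ends at `p + 2δx = p - δx`. For `δ = -1`, `raised` keeps the end and
-- makes the walk level, so that it ends where it now starts.
under-end : ∀ {n m x} {u : Vec Step n} → n ≡ suc m * 2 → Tilt (suc m) x u -[1+ 0 ] →
            ∀ p → end p u ≡ move x p
under-end {x = x} n≡2m t p = trans (same-end R) (level-end n≡2m (new-tilt R) (move x p))
  where R = raised x p (trans (sym (+-identityʳ _)) (against t)) t

over-end : ∀ {n m x} {u : Vec Step n} → n ≡ suc m * 2 → Tilt (suc m) x u +[1+ 0 ] →
           ∀ p → end p u ≡ move (opposite x) p
over-end {x = x} {u} n≡2m t p =
  trans (cong (λ q → end q u) (sym there-and-back))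
    (trans (same-end R) (level-end n≡2m (new-tilt R) _))
  where
  there-and-back : move x (move (opposite x) p) ≡ p
  there-and-back = trans (cong (λ y → move y (move (opposite x) p)) (sym (opposite-involutive x)))
                         (move-back (opposite x) p)
  R = lowered x (move (opposite x) p) (trans (sym (+-identityʳ _)) (along t)) t

-- Descent on the sum of the absolute tilts.

∣raise∣ : ∀ a → ∣ raise -[1+ a ] ∣ ≡ a
∣raise∣ zero    = refl
∣raise∣ (suc a) = refl

∣lower²∣ : ∀ a → ∣ lower (lower +[1+ a ]) ∣ ≤ suc a
∣lower²∣ zero    = ≤-refl
∣lower²∣ (suc a) = ≤-trans (n≤1+n a) (n≤1+n (suc a))

size : ℤ → ℤ → ℤ → ℕ
size α β γ = ∣ α ∣ + (∣ β ∣ + ∣ γ ∣)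

size-rotate : ∀ α β γ → size β γ α ≡ size α β γ
size-rotate α β γ = 
  trans (sym (+-assoc (∣ β ∣) (∣ γ ∣) (∣ α ∣))) (+-comm (∣ β ∣ + ∣ γ ∣) (∣ α ∣))

module Connected (n : Fin 3 → ℕ) .(nonZero : ∀ c → NonZero (n c))
                 (h : Fin 3 → ℕ) (n≡2h : ∀ l → n l ≡ suc (h l) * 2) where

  open Straightening n nonZero (suc ∘ h) n≡2h public

  private variable
    i j k l : Fin 3
    p q r : Fin 3
    c : Coloring G
    x : Step
    α β γ : ℤ

  Word : Fin 3 → Set
  Word l = Vec Step (n l)

  module _ {i j k : Fin 3} (D : Distinct i j k) {p q r : Fin 3} (S : Distinct p q r) where

    reorder₁ : ∀ {u u′ v w} (E : Distinct (end p u) (end q v) (end r w))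
               (E′ : Distinct (end p u′) (end q v) (end r w)) → u ⇄* u′ →
               straights S u v w E D ≃ straights S u′ v w E′ D
    reorder₁ E E′ ε        = straights-recolor D S E S E′ 0F ≈-refl ≈-refl ≈-refl
    reorder₁ E E′ (e ◅ es) =
      straights-recolor D S E S E₁ _ (proj₂ (⇄-agree e p)) ≈-refl ≈-refl ◅◅ reorder₁ E₁ E′ es
      where E₁ = Distinct-subst (⇄-end e p) refl refl E

    reorder₂ : ∀ {u v v′ w} (E : Distinct (end p u) (end q v) (end r w))
               (E′ : Distinct (end p u) (end q v′) (end r w)) → v ⇄* v′ →
               straights S u v w E D ≃ straights S u v′ w E′ D
    reorder₂ E E′ ε        = straights-recolor D S E S E′ 0F ≈-refl ≈-refl ≈-refl
    reorder₂ E E′ (e ◅ es) =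
      straights-recolor D S E S E₁ _ ≈-refl (proj₂ (⇄-agree e q)) ≈-refl ◅◅ reorder₂ E₁ E′ es
      where E₁ = Distinct-subst refl (⇄-end e q) refl E

    reorder₃ : ∀ {u v w w′} (E : Distinct (end p u) (end q v) (end r w))
               (E′ : Distinct (end p u) (end q v) (end r w′)) → w ⇄* w′ →
               straights S u v w E D ≃ straights S u v w′ E′ D
    reorder₃ E E′ ε        = straights-recolor D S E S E′ 0F ≈-refl ≈-refl ≈-refl
    reorder₃ E E′ (e ◅ es) =
      straights-recolor D S E S E₁ _ ≈-refl ≈-refl (proj₂ (⇄-agree e r)) ◅◅ reorder₃ E₁ E′ es
      where E₁ = Distinct-subst refl refl (⇄-end e r) E

    reorder : ∀ {u u′ v v′ w w′} (E : Distinct (end p u) (end q v) (end r w))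
              (E′ : Distinct (end p u′) (end q v′) (end r w′)) →
              u ⇄* u′ → v ⇄* v′ → w ⇄* w′ →
              straights S u v w E D ≃ straights S u′ v′ w′ E′ D
    reorder E E′ a b c = reorder₁ E E₁ a ◅◅ reorder₂ E₁ E₂ b ◅◅ reorder₃ E₂ E′ c
      where
      E₁ = Distinct-subst (⇄*-end a p) refl refl E
      E₂ = Distinct-subst refl (⇄*-end b q) refl E₁

  -- The orientation x says in which cyclic order the copies i, j and k start:
  -- with p, p + x and p - x.
  data Tilted (x : Step) (α β γ : ℤ) (c : Coloring G) : Set where
    tilted : (D : Distinct i j k) (S : Distinct p q r) → q ≡ move x p → r ≡ move (opposite x) p →
             ∀ {u v w} (E : Distinct (end p u) (end q v) (end r w)) →
             Tilt (suc (h i)) x u α → Tilt (suc (h j)) x v β → Tilt (suc (h k)) x w γ →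
             c ≃ straights S u v w E D → Tilted x α β γ c

  rotate : Tilted x α β γ c → Tilted x β γ α c
  rotate {x} (tilted {p = p} D S refl refl E a b d c≃) =
    tilted (Distinct-rotate D) (Distinct-rotate S) (sym (move-twice x p)) (sym (move-back x p))
      (Distinct-rotate E) b d a (c≃ ◅◅ straights-rotate D S E)

  -- Listing the second copy first reverses the cyclic order of the starting colors, and with it the
  -- direction in which tilts are measured.
  mirror : Tilted x α β γ c → Tilted (opposite x) (- β) (- α) (- γ) c
  mirror {x} (tilted {p = p} D S refl refl E a b d c≃) =
    tilted (Distinct-swap D) (Distinct-swap S) (sym (move-back x p))
      (trans (sym (move-twice x p)) (cong (λ y → move y (move x p)) (sym (opposite-involutive x))))
      (Distinct-swap E) (Tilt-reverse b) (Tilt-reverse a) (Tilt-reverse d)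
      (c≃ ◅◅ straights-swap D S E)

  -- After reordering, copies `i` and `j` trade their starts `p` and `q` in one recoloring with
  -- common class `r`, while copy `k` does not change. Listing `j` before `i` restores the
  -- orientation `x`, which is why `β` comes first.
  exchanged : ∀ {D : Distinct i j k} {S : Distinct p q r} {u v w}
                {E : Distinct (end p u) (end q v) (end r w)}
              {α β γ} → q ≡ move x p → r ≡ move (opposite x) p →
              c ≃ straights S u v w E D →
              Recolored (suc (h i)) x r p u q α → Recolored (suc (h j)) x r q v p β →
              Tilt (suc (h k)) x w γ → Tilted x β α γ c
  exchanged {p = p} {q} {r} {D = D} {S} {u} {v} {w} {E} q≡ r≡ c≃ A B d =
    tilted (Distinct-swap D) (Distinct-swap S′) q≡ r≡ (Distinct-swap E′)
      (new-tilt B) (new-tilt A) d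
      (c≃ ◅◅ reorder D S E E₁ (reordered A) (reordered B) ε
          ◅◅ straights-recolor D S E₁ S′ E′ r (agree A) (agree B) ≈-refl
          ◅◅ straights-swap D S′ E′)
    where
    S′ = Distinct-swap S
    E₁ = Distinct-subst (⇄*-end (reordered A) p) (⇄*-end (reordered B) q) refl E
    E′ = Distinct-subst (same-end A) (same-end B) refl E

  -- Positive half lengths matter here: a step of the kind counted exists even for `b = 0`.
  enough : ∀ {c} m b → Balance c (suc m) (+ b) → c ≡ suc (m + b)
  enough {c} m b q = trans (sym (+-identityʳ c)) q

  -- Up to the order of the copies, `(α , β)` becomes `(α + 1 , β - 1)`. That `α` is at most 0 and
  -- the second tilt at least 0 guarantees the steps to be flipped.
  transfer : ∀ {a b} → - α ≡ + a → Tilted x α (+ b) γ c → Tilted x (lower (+ b)) (raise α) γ c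
  transfer {α} {x} {a = a} {b} -α≡a (tilted {i = i} {j} {p = p} D S refl refl {u = u} E s t t′ c≃) =
    exchanged {D = D} {S} {E = E} refl refl c≃
      (raised x p (enough (h i) a (subst (Balance (count (opposite x) u) _) -α≡a (against s))) s)
      (lowered x p (enough (h j) b (along t)) t) t′

  -- Here `(α , β)` becomes `(α - 2 , β - 1)`; a positive first tilt provides the two steps `x`.
  transfer-two : ∀ {a b} → Tilted x +[1+ a ] (+ b) γ c →
                 Tilted x (lower (+ b)) (lower (lower +[1+ a ])) γ c
  transfer-two {x} {a = a} {b} (tilted {i = i} {j} {p = p} D S refl refl E s t t′ c≃) =
    exchanged {D = D} {S} {E = E} refl refl c≃
      (lowered-twice x p (trans (enough (h i) (suc a) (along s)) (cong suc (+-suc (h i) a))) s)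
      (lowered x p (enough (h j) b (along t)) t) t′

  -- The first copy would end with `p + x`, the start and hence the end of the level second copy.
  ¬under-level : ¬ Tilted x -[1+ 0 ] +0 γ c
  ¬under-level (tilted {i = i} {j} {p = p} D S refl refl E s t _ _) =
    proj₁ E (trans (under-end (n≡2h i) s p) (sym (level-end (n≡2h j) t _)))

  -- The first copy would end with `p - x`, as does the level third copy.
  ¬over-level : ¬ Tilted x +[1+ 0 ] β +0 c
  ¬over-level (tilted {i = i} {k = k} {p = p} D S refl refl E s _ t _) =
    proj₂ (proj₂ E) (trans (over-end (n≡2h i) s p) (sym (level-end (n≡2h k) t _)))

  Level : Coloring G → Set
  Level c = ∃ λ x → Tilted x +0 +0 +0 c

  Reducible : ℕ → Coloring G → Set
  Reducible m c = ∀ {x α β γ} → size α β γ < m → Tilted x α β γ c → Level c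

  module _ {m : ℕ} {c : Coloring G} (smaller : Reducible m c) where

    under-over : ∀ a b → size -[1+ a ] +[1+ b ] γ ≤ m → Tilted x -[1+ a ] +[1+ b ] γ c → Level c
    under-over {γ} a b s t = smaller (≤-trans bound s) (transfer refl t)
      where
      bound : b + (∣ raise -[1+ a ] ∣ + ∣ γ ∣) < suc a + (suc b + ∣ γ ∣)
      bound rewrite ∣raise∣ a | +-exchange b a (∣ γ ∣) = s≤s (+-monoʳ-≤ a (n≤1+n _))

    -- The first transfer replaces `(α , 0)` by `(-1 , α + 1)` without changing the size. A rotation
    -- then pairs the copy with `α + 1` with the positive one, and the second transfer saves 2.
    under-level-over : ∀ a b → size -[1+ a ] +0 +[1+ b ] ≤ m →
                       Tilted x -[1+ a ] +0 +[1+ b ] c → Level c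
    under-level-over zero    b s t = ⊥-elim (¬under-level t)
    under-level-over (suc a) b s t =
      smaller (≤-trans bound s) (transfer refl (rotate (transfer refl t)))
      where
      bound : b + (∣ raise -[1+ a ] ∣ + 1) < suc (suc a) + suc b
      bound rewrite ∣raise∣ a | +-exchange b a 1 | +-comm b 1 = n≤1+n _

    -- The second tilt drops by 1, while `|α - 2| ≤ α` for the first because `α ≥ 1`.
    over-over : ∀ a b → size +[1+ a ] +[1+ b ] γ ≤ m → Tilted x +[1+ a ] +[1+ b ] γ c → Level c
    over-over {γ} a b s t = smaller (≤-trans bound s) (transfer-two t)
      where
      bound : b + (∣ lower (lower +[1+ a ]) ∣ + ∣ γ ∣) < suc a + (suc b + ∣ γ ∣)
      bound rewrite +-suc a (b + ∣ γ ∣) = s≤s (≤-trans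
        (+-monoʳ-≤ b (+-monoˡ-≤ (∣ γ ∣) (∣lower²∣ a))) (≤-reflexive (+-exchange b (suc a) (∣ γ ∣))))

    -- A tilt of at least 2 loses 2, and a single unit appears on a level copy.
    over-level-level : ∀ a → size +[1+ a ] +0 +0 ≤ m → Tilted x +[1+ a ] +0 +0 c → Level c
    over-level-level zero    s t = ⊥-elim (¬over-level t)
    over-level-level (suc a) s t = smaller s (transfer-two t)

    rotated : ∀ α β γ → size α β γ ≤ m → size β γ α ≤ m
    rotated α β γ = subst (_≤ m) (sym (size-rotate α β γ))

    rotated² : ∀ α β γ → size α β γ ≤ m → size γ α β ≤ m
    rotated² α β γ = rotated β γ α ∘ rotated α β γ

    none-under : ∀ a b d → size (+ a) (+ b) (+ d) ≤ m → Tilted x (+ a) (+ b) (+ d) c → Level c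
    none-under zero    zero    zero    s t = _ , t
    none-under (suc a) (suc b) d       s t = over-over a b s t
    none-under zero    (suc b) (suc d) s t =
      over-over b d (rotated +0 +[1+ b ] +[1+ d ] s) (rotate t)
    none-under (suc a) zero    (suc d) s t =
      over-over d a (rotated² +[1+ a ] +0 +[1+ d ] s) (rotate (rotate t))
    none-under (suc a) zero    zero    s t = over-level-level a s t
    none-under zero    (suc b) zero    s t =
      over-level-level b (rotated +0 +[1+ b ] +0 s) (rotate t)
    none-under zero    zero    (suc d) s t =
      over-level-level d (rotated² +0 +0 +[1+ d ] s) (rotate (rotate t))

    none-over : ∀ a b d → size (- + a) (- + b) (- + d) ≤ m →
                Tilted x (- + a) (- + b) (- + d) c → Level c
    none-over {x} a b d s t = none-under b a d
      (subst (_≤ m)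
        (trans (cong₂ _+_ (∣-i∣≡∣i∣ (+ a)) (cong₂ _+_ (∣-i∣≡∣i∣ (+ b)) (∣-i∣≡∣i∣ (+ d))))
               (+-exchange a b d)) s)
      (subst₂ (λ β γ → Tilted (opposite x) (+ b) β γ c)
        (neg-involutive (+ a)) (neg-involutive (+ d))
        (subst (λ α → Tilted (opposite x) α _ _ c) (neg-involutive (+ b)) (mirror t)))

    -- If both signs occur, then in cyclic order some negative tilt is followed by a positive one,
    -- directly or after a zero, and a rotation brings it to the front. Otherwise `none-under` or
    -- `none-over` applies.
    level-below : ∀ α β γ → size α β γ ≤ m → Tilted x α β γ c → Level c
    level-below -[1+ a ] +[1+ b ] γ        s t = under-over a b s t
    level-below α        -[1+ b ] +[1+ d ] s t =
      under-over b d (rotated α -[1+ b ] +[1+ d ] s) (rotate t)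
    level-below +[1+ a ] β        -[1+ d ] s t =
      under-over d a (rotated² +[1+ a ] β -[1+ d ] s) (rotate (rotate t))
    level-below -[1+ a ] +0       +[1+ d ] s t = under-level-over a d s t
    level-below +0       +[1+ b ] -[1+ d ] s t =
      under-level-over d b (rotated² +0 +[1+ b ] -[1+ d ] s) (rotate (rotate t))
    level-below +[1+ a ] -[1+ b ] +0       s t =
      under-level-over b a (rotated +[1+ a ] -[1+ b ] +0 s) (rotate t)
    level-below (+ a)    (+ b)    (+ d)    s t = none-under a b d s t
    level-below -[1+ a ] +0       +0       s t = none-over (suc a) 0 0 s t
    level-below +0       -[1+ b ] +0       s t = none-over 0 (suc b) 0 s t
    level-below +0       +0       -[1+ d ] s t = none-over 0 0 (suc d) s t
    level-below -[1+ a ] -[1+ b ] +0       s t = none-over (suc a) (suc b) 0 s t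
    level-below -[1+ a ] +0       -[1+ d ] s t = none-over (suc a) 0 (suc d) s t
    level-below +0       -[1+ b ] -[1+ d ] s t = none-over 0 (suc b) (suc d) s t
    level-below -[1+ a ] -[1+ b ] -[1+ d ] s t = none-over (suc a) (suc b) (suc d) s t

  reducible : ∀ m → Reducible m c
  reducible (suc m) (s≤s s) t = level-below (reducible m) _ _ _ s t

  oriented : ∀ {p q r : Fin 3} → Distinct p q r → ∃ λ x → q ≡ move x p × r ≡ move (opposite x) p
  oriented {p} {q} S with step-towards p q (proj₁ S)
  ... | x , refl = x , refl , sym (third-of-three S
    (≢-sym (proj₂ (proj₂ (step-distinct x p)))) (≢-sym (proj₁ (proj₂ (step-distinct x p)))))

  level : ∀ c → Level c
  level c with straighten c
  ... | straightened {i} {j} {k} D S {u} {v} {w} E c≃ with oriented S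
  ... | x , q≡ , r≡ with tilt (suc (h i)) (n≡2h i) x u | tilt (suc (h j)) (n≡2h j) x v
                       | tilt (suc (h k)) (n≡2h k) x w
  ... | α , a | β , b | γ , d = reducible _ ≤-refl (tilted D S q≡ r≡ E a b d c≃)

  -- Connecting the level colorings.

  alternates : Step → ∀ l → Word l
  alternates x l = alternate x (n l)

  alternates-end : ∀ x l p → p ≡ end p (alternates x l)
  alternates-end x l p = sym (alternate-end (suc (h l)) (n≡2h l) x p)

  alternating-ends : ∀ x → Distinct i j k → Distinct p q r →
    Distinct (end p (alternates x i)) (end q (alternates x j)) (end r (alternates x k))
  alternating-ends {i} {j} {k} x _ =
    Distinct-subst (alternates-end x i _) (alternates-end x j _) (alternates-end x k _)

  alternating : Step → Distinct i j k → Distinct p q r → Coloring G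
  alternating {i} {j} {k} x D S = straights S (alternates x i) (alternates x j) (alternates x k)
    (alternating-ends x D S) D

  standard : Distinct p q r → Coloring G
  standard = alternating ⊕ 012-distinct

  opposite-alternates : ∀ l → alternate ⊖ (n l) ⇄* alternate ⊕ (n l)
  opposite-alternates l = same-count _ _ λ z →
    trans (count-alternate (suc (h l)) (n≡2h l) ⊖ z)
          (sym (count-alternate (suc (h l)) (n≡2h l) ⊕ z))

  -- Transposing the two colors other than `a` keeps class `a` but reverses all steps; reordering
  -- the alternating words restores their direction.
  standard-reflect : ∀ a (S : Distinct p q r) → standard S ≃ standard (Distinct-reflect a S)
  standard-reflect a S =
    straights-recolor 012-distinct S (alternating-ends ⊕ 012-distinct S)
      S′ (alternating-ends ⊖ 012-distinct S′) a
      (alternate-reflect (n 0F) a ⊕ _) (alternate-reflect (n 1F) a ⊕ _)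
      (alternate-reflect (n 2F) a ⊕ _)
    ◅◅ reorder 012-distinct S′
         (alternating-ends ⊖ 012-distinct S′) (alternating-ends ⊕ 012-distinct S′)
         (opposite-alternates 0F) (opposite-alternates 1F) (opposite-alternates 2F)
    where S′ = Distinct-reflect a S

  standard-cong : ∀ {p q r p′ q′ r′} (S : Distinct p q r) (S′ : Distinct p′ q′ r′) →
                  p ≡ p′ → q ≡ q′ → r ≡ r′ → standard S ≃ standard S′
  standard-cong S S′ refl refl refl = straights-recolor 012-distinct
    S (alternating-ends ⊕ 012-distinct S) S′ (alternating-ends ⊕ 012-distinct S′) 0F
    ≈-refl ≈-refl ≈-refl

  canonical : Coloring G
  canonical = standard 012-distinct

  from-zero : ∀ {q r} (S : Distinct 0F q r) → standard S ≃ canonical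
  from-zero {0F} S = ⊥-elim (proj₁ S refl)
  from-zero {1F} S = standard-cong S 012-distinct refl refl
    (sym (third-of-three S (λ ()) (λ ())))
  from-zero {2F} S = standard-reflect 0F S ◅◅
    standard-cong (Distinct-reflect 0F S) 012-distinct refl refl
      (sym (third-of-three (Distinct-reflect 0F S) (λ ()) (λ ())))

  -- At most two transpositions are used: one brings the first starting color to 0, the other fixes
  -- 0 and puts the remaining two in order.
  standard≃canonical : (S : Distinct p q r) → standard S ≃ canonical
  standard≃canonical {0F} S = from-zero S
  standard≃canonical {1F} S = standard-reflect 2F S ◅◅ from-zero (Distinct-reflect 2F S)
  standard≃canonical {2F} S = standard-reflect 1F S ◅◅ from-zero (Distinct-reflect 1F S)

  alternating-standard : (D : Distinct i j k) (S : Distinct p q r) →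
                         ∃ λ p′ → ∃₂ λ q′ r′ → ∃ λ (S′ : Distinct p′ q′ r′) →
                         alternating ⊕ D S ≃ standard S′
  alternating-standard {p = p} {q} {r} D S = start 0F , start 1F , start 2F , S′ ,
    recolor 012-distinct _
      (assembled-boundary D (straight-boundary S _ _ _ (alternating-ends ⊕ D S)))
      (straight-boundary S′ _ _ _ (alternating-ends ⊕ 012-distinct S′)) 0F
      (same 0F) (same 1F) (same 2F)
    where
    start : Fin 3 → Fin 3
    start = assemble D p q r
    S′ : Distinct (start 0F) (start 1F) (start 2F)
    S′ = injective {0F} {1F} (λ ()) , injective {1F} {2F} (λ ()) , injective {0F} {2F} (λ ())
      where
      injective : Injective₃ start
      injective = assemble-injective {T = λ _ → Fin 3} D (λ {_} p → p) S
    lad : ∀ l → Fin 3 → Lad (n l)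
    lad l p = straight p (alternate ⊕ (n l))
    same : ∀ l → assemble {Lad ∘ n} D (lad _ p) (lad _ q) (lad _ r) l ≈[ 0F ] lad l (start l)
    same = assemble-all {Lad ∘ n} D (λ l M → M ≈[ 0F ] lad l (start l))
      (≡-≈ (cong (lad _) (sym (assemble-1 {λ _ → Fin 3} D))) ≈-refl)
      (≡-≈ (cong (lad _) (sym (assemble-2 {λ _ → Fin 3} D))) ≈-refl)
      (≡-≈ (cong (lad _) (sym (assemble-3 {λ _ → Fin 3} D))) ≈-refl)

  ≃-canonical : ∀ c → c ≃ canonical
  ≃-canonical c with level c
  ... | x , tilted {i} {j} {k} D S _ _ E a b d c≃ with alternating-standard D S
  ... | _ , _ , _ , S′ , D≃ = c≃
    -- All tilts are 0, so each word has as many up-steps as down-steps and can be made alternating.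
    ◅◅ reorder D S E (alternating-ends ⊕ D S)
         (level-alternate (n≡2h i) a) (level-alternate (n≡2h j) b) (level-alternate (n≡2h k) d)
    ◅◅ D≃ ◅◅ standard≃canonical S′

  one-class : ExactlyOneKempeClass G
  one-class = canonical , λ c d → ≃⇒kempe (≃-canonical c ◅◅ ≃-sym (≃-canonical d))

theorem4 : (i j k : ℕ) .{{_ : NonZero i}} .{{_ : NonZero j}} .{{_ : NonZero k}} →
    2 ∣ i → 2 ∣ j → 2 ∣ k →
    ExactlyOneKempeClass (Eggbeater i j k)
-- The quotients by 2 are positive because `i`, `j` and `k` are; `h` holds their predecessors.
theorem4 _ _ _ (divides (suc a) refl) (divides (suc b) refl) (divides (suc c) refl) =
  Connected.one-class _ _ (λ { 0F → a ; 1F → b ; 2F → c })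
    λ { 0F → refl ; 1F → refl ; 2F → refl }
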